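{- A function $u=\sum_{n=0}^\infty c_nf_n\in C_0(O,\overline{K}_c)$ belongs to $A(O,\overline{K}_c)$ if and only if $$q^{\frac{q^n}{q-1}}|c_n|\to 0\quad\text{for } n\to\infty .$$
   Context: Let $\mathbf F_q$ be the finite field with $q=p^\gamma$ elements ($p$ prime, $\gamma\ge 1$), and let $K=\mathbf F_q((x))$ with absolute value $|z|=q^{ -n}$ for $z=\sum_{i=n}^\infty\zeta_i x^i$, $\zeta_i\in\mathbf F_q$, $\zeta_n\neq 0$. Let $O=\{z\in K:|z|\le1\}$ and let $\overline{K}_c$ be the completion of an algebraic closure of $K$, with the extended absolute value. A function $u:O\to\overline{K}_c$ is $\mathbf F_q$-linear if $u(t_1+t_2)=u(t_1)+u(t_2)$ and $u(\alpha t)=\alpha u(t)$ for all $t,t_1,t_2\in O$, $\alpha\in\mathbf F_q$. $C_0(O,\overline{K}_c)$ is the Banach space of all continuous $\mathbf F_q$-linear functions $O\to\overline{K}_c$ with the supremum norm. Put $[i]=x^{q^i}-x$, $D_0=1$, $D_i=[i]\,[i-1]^q\cdots[1]^{q^{i-1}}$ for $i\ge1$. The normalized Carlitz polynomials are $f_i(t)=D_i^{ -1}e_i(t)$, $i\ge 0$, where $e_0(t)=t$ and $e_i(t)=\prod_{m\in\mathbf F_q[x],\,\deg m<i}(t-m)$ for $i\ge1$ (the product includes $m=0$). It is known that every $u\in C_0(O,\overline{K}_c)$ has a unique uniformly convergent expansion $u=\sum_{n\ge0}c_nf_n$ with $c_n\in\overline{K}_c$, $c_n\to0$, and $\|u\|=\sup_n|c_n|$;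 the $c_n$ in the claim are these coefficients. $A(O,\overline{K}_c)\subset C_0(O,\overline{K}_c)$ denotes the space of all functions $O\to\overline{K}_c$ of the form $u(t)=\sum_{n=0}^\infty a_nt^{q^n}$ with $a_n\in\overline{K}_c$, $a_n\to0$. -}

module Defs where

open import Algebra using (CommutativeRing; RawRing)
open import Algebra.Apartness using (HeytingCommutativeRing; HeytingField)
open import Algebra.Morphism.Structures using (module RingMorphisms)
import Algebra.Apartness.Properties.HeytingCommutativeRing as HeytingProperties
import Algebra.Properties.CommutativeMonoid.Sum as BigOp
import Algebra.Properties.Ring as RingProperties
import Algebra.Properties.Semiring.Exp as Exp
open import Data.Empty using (⊥-elim)
open import Data.Fin using (Fin; toℕ)
import Data.Fin.Properties as Fin
open import Data.Integer as ℤ using (ℤ; +_; -[1+_])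
import Data.Integer.Properties as ℤ
open import Data.List using (List; []; _∷_; foldr; map; allFin; cartesianProductWith)
open import Data.Nat as ℕ using (ℕ; zero; suc; NonZero; z≤n; s≤s)
open import Data.Nat.Primality using (Prime; prime⇒nonZero; prime⇒nonTrivial)
import Data.Nat.Properties as ℕ
open import Data.Product using (Σ-syntax; ∃-syntax; _×_; _,_; proj₁; proj₂)
open import Data.Rational as ℚ using (ℚ)
import Data.Rational.Properties as ℚ
open import Data.Sum using (_⊎_; inj₁; inj₂)
open import Data.Vec using (Vec; []; _∷_)
open import Data.Vec.Relation.Unary.Any using (Any)
import Data.Vec as Vec
open import Function using (Func; Inverse; _∘_)
open import Level using (Level; _⊔_) renaming (suc to lsuc)
open import Relation.Binary using (Setoid)
import Relation.Binary.Construct.On as On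
import Relation.Binary.Reasoning.Setoid as SetoidReasoning
open import Relation.Binary.PropositionalEquality as ≡ using (_≡_)
open import Relation.Nullary using (¬_; Dec; yes; no)
import Relation.Nullary.Decidable as Dec

private
  variable
    f f₁ f₂ c ℓ₁ ℓ₂ c′ ℓ₁′ ℓ₂′ : Level

module Field (𝔽 : HeytingField c ℓ₁ ℓ₂) where
  open HeytingField 𝔽 public using (heytingCommutativeRing; _#_; #⇒invertible)
  open HeytingCommutativeRing heytingCommutativeRing public using (commutativeRing)
  open CommutativeRing commutativeRing public
  open Exp semiring public using (_^_)
  open BigOp +-commutativeMonoid public using (sum)
  open BigOp *-commutativeMonoid public using () renaming (sum to product)

  ∑< : ℕ → (ℕ → Carrier) → Carrier
  ∑< n g = sum {n} (g ∘ toℕ)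

  ∏< : ℕ → (ℕ → Carrier) → Carrier
  ∏< n g = product {n} (g ∘ toℕ)

  -- Coefficients are listed from the constant term upwards.
  eval : ∀ {n} → Vec Carrier n → Carrier → Carrier
  eval []       z = 0#
  eval (a ∷ as) z = a + z * eval as z

  inverse : ∀ {z} → z # 0# → Carrier
  inverse z#0 = proj₁ (#⇒invertible z#0)

record FiniteField c ℓ₁ ℓ₂ : Set (lsuc (c ⊔ ℓ₁ ⊔ ℓ₂)) where
  field
    p γ          : ℕ
    p-prime      : Prime p
    γ-nonZero    : NonZero γ
    heytingField : HeytingField c ℓ₁ ℓ₂
    enumeration  : Inverse (≡.setoid (Fin (p ℕ.^ γ))) (Field.setoid heytingField)

  open Field heytingField public

  q : ℕ
  q = p ℕ.^ γ

  elements : List Carrier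
  elements = map (Inverse.to enumeration) (allFin q)

  1<q : 1 ℕ.< q
  1<q = ℕ.<-≤-trans (ℕ.nonTrivial⇒n>1 p) (p≤p^ γ γ-nonZero)
    where
    instance
      _ = prime⇒nonTrivial p-prime
      _ = prime⇒nonZero p-prime
    p≤p^ : ∀ n → NonZero n → p ℕ.≤ p ℕ.^ n
    p≤p^ (suc n) _ = ℕ.m≤m*n p (p ℕ.^ n) {{ℕ.m^n≢0 p n}}

  instance
    q∸1-nonZero : NonZero (q ℕ.∸ 1)
    q∸1-nonZero = ℕ.>-nonZero (ℕ.m<n⇒0<n∸m 1<q)

  infix 4 _≟_
  _≟_ : ∀ α β → Dec (α ≈ β)
  α ≟ β = Dec.map′ injective from-cong (from α Fin.≟ from β)
    where
    open Inverse enumeration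
    injective : from α ≡ from β → α ≈ β
    injective eq = trans (sym (strictlyInverseˡ α)) (trans (to-cong eq) (strictlyInverseˡ β))

module LaurentSeries (𝐅 : FiniteField f f₁ f₂) where
  private module F = FiniteField 𝐅

  -- `start` is only some bound below which the coefficients vanish: the
  -- coefficient at `start` is allowed to be 0.
  record K : Set (f ⊔ f₁) where
    field
      coeff    : ℤ → F.Carrier
      start    : ℤ
      vanishes : ∀ i → i ℤ.< start → coeff i F.≈ F.0#
  open K public

  infix 4 _≈ᴷ_
  _≈ᴷ_ : K → K → Set f₁
  z ≈ᴷ w = ∀ i → coeff z i F.≈ coeff w i

  infixl 6 _+ᴷ_
  _+ᴷ_ : K → K → K
  z +ᴷ w = record
    { coeff    = λ i → coeff z i F.+ coeff w i
    ; start    = start z ℤ.⊓ start w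
    ; vanishes = λ i i< → F.trans
        (F.+-cong (vanishes z i (ℤ.<-≤-trans i< (ℤ.i⊓j≤i (start z) (start w))))
                  (vanishes w i (ℤ.<-≤-trans i< (ℤ.i⊓j≤j (start z) (start w)))))
        (F.+-identityˡ F.0#)
    }

  -ᴷ_ : K → K
  -ᴷ z = record
    { coeff    = λ i → F.- coeff z i
    ; start    = start z
    ; vanishes = λ i i< → F.trans (F.-‿cong (vanishes z i i<)) (RingProperties.-0#≈0# F.ring)
    }

  infixr 7 _·_
  _·_ : F.Carrier → K → K
  α · z = record
    { coeff    = λ i → α F.* coeff z i
    ; start    = start z
    ; vanishes = λ i i< → F.trans (F.*-congˡ (vanishes z i i<)) (F.zeroʳ α)
    }

  infixl 7 _*ᴷ_
  _*ᴷ_ : K → K → K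
  z *ᴷ w = record
    { coeff    = λ i → convolution (i ℤ.- s)
    ; start    = s
    ; vanishes = λ i i< → vanish (i ℤ.- s) (i-s<0 i i<)
    }
    where
    s : ℤ
    s = start z ℤ.+ start w

    -- The coefficient of x^(s + k).
    convolution : ℤ → F.Carrier
    convolution -[1+ _ ] = F.0#
    convolution (+ k)    = F.∑< (suc k) λ j →
      coeff z (start z ℤ.+ + j) F.* coeff w (start w ℤ.+ + (k ℕ.∸ j))

    i-s<0 : ∀ i → i ℤ.< s → i ℤ.- s ℤ.< + 0
    i-s<0 i i<s = ≡.subst (i ℤ.- s ℤ.<_) (ℤ.+-inverseʳ s) (ℤ.+-monoˡ-< (ℤ.- s) i<s)

    vanish : ∀ k → k ℤ.< + 0 → convolution k F.≈ F.0#
    vanish -[1+ _ ] _          = F.refl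
    vanish (+ _)    (ℤ.+<+ ())

  const : F.Carrier → K
  const α = record { coeff = a ; start = + 0 ; vanishes = vanish }
    where
    a : ℤ → F.Carrier
    a (+ 0) = α
    a _     = F.0#
    vanish : ∀ i → i ℤ.< + 0 → a i F.≈ F.0#
    vanish -[1+ _ ] _          = F.refl
    vanish (+ _)    (ℤ.+<+ ())

  X : K
  X = record { coeff = a ; start = + 1 ; vanishes = vanish }
    where
    a : ℤ → F.Carrier
    a (+ 1) = F.1#
    a _     = F.0#
    vanish : ∀ i → i ℤ.< + 1 → a i F.≈ F.0#
    vanish -[1+ _ ] _                  = F.refl
    vanish (+ 0)    _                  = F.refl
    vanish (+ suc _) (ℤ.+<+ (s≤s ()))

  rawRing : RawRing (f ⊔ f₁) f₁
  rawRing = record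
    { Carrier = K ; _≈_ = _≈ᴷ_ ; _+_ = _+ᴷ_ ; _*_ = _*ᴷ_ ; -_ = -ᴷ_
    ; 0# = const F.0# ; 1# = const F.1# }

  ∣_∣≡q^-_ : K → ℤ → Set f₁
  ∣ z ∣≡q^- n = (∀ i → i ℤ.< n → coeff z i F.≈ F.0#) × ¬ (coeff z n F.≈ F.0#)

  -- Vacuous for z = 0, as it should be, since then |z| = 0.
  ∣_∣≤q^_ : K → ℤ → Set f₁
  ∣ z ∣≤q^ k = ∀ n → ∣ z ∣≡q^- n → ℤ.- n ℤ.≤ k

  record O : Set (f ⊔ f₁) where
    constructor _,_
    field
      ⌊_⌋   : K
      ∣⌊⌋∣≤1 : ∣ ⌊_⌋ ∣≤q^ (+ 0)
  open O public

  K-setoid : Setoid (f ⊔ f₁) f₁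
  K-setoid = record
    { Carrier = K
    ; _≈_ = _≈ᴷ_
    ; isEquivalence = record
      { refl  = λ _ → F.refl
      ; sym   = λ e i → F.sym (e i)
      ; trans = λ e e′ i → F.trans (e i) (e′ i)
      }
    }

  O-setoid : Setoid (f ⊔ f₁) f₁
  O-setoid = On.setoid K-setoid ⌊_⌋

  private
    search : ∀ (z : K) m →
      (∀ i → i ℤ.< start z ℤ.+ + m → coeff z i F.≈ F.0#) ⊎
      (∃[ n ] n ℤ.< start z ℤ.+ + m × ∣ z ∣≡q^- n)
    search z zero = inj₁ λ i i< →
      vanishes z i (≡.subst (i ℤ.<_) (ℤ.+-identityʳ (start z)) i<)
    search z (suc m) with search z m
    ... | inj₂ (n , n< , ord) =
      inj₂ (n , ℤ.<-trans n< (ℤ.+-monoʳ-< (start z) (ℤ.+<+ (ℕ.n<1+n m))) , ord)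
    ... | inj₁ below with coeff z (start z ℤ.+ + m) F.≟ F.0#
    ...   | no  ≉0 = inj₂ (_ , ℤ.+-monoʳ-< (start z) (ℤ.+<+ (ℕ.n<1+n m)) , below , ≉0)
    ...   | yes ≈0 = inj₁ upTo
      where
      s+1+m : start z ℤ.+ + suc m ≡ ℤ.suc (start z ℤ.+ + m)
      s+1+m = ≡.trans (≡.cong (ℤ._+_ (start z)) (ℤ.pos-+ 1 m))
             (≡.trans (≡.sym (ℤ.+-assoc (start z) (+ 1) (+ m)))
             (≡.trans (≡.cong (ℤ._+ + m) (ℤ.+-comm (start z) (+ 1)))
                      (ℤ.+-assoc (+ 1) (start z) (+ m))))
      upTo : ∀ i → i ℤ.< start z ℤ.+ + suc m → coeff z i F.≈ F.0#
      upTo i i< with i ℤ.≟ start z ℤ.+ + m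
      ... | yes ≡.refl = ≈0
      ... | no  i≢     = below i (ℤ.≤∧≢⇒< i≤ i≢)
        where
        i≤ : i ℤ.≤ start z ℤ.+ + m
        i≤ = ≡.subst (i ℤ.≤_) (ℤ.pred-suc _)
               (ℤ.i<j⇒i≤pred[j] (≡.subst (i ℤ.<_) s+1+m i<))

    distance : ∀ i s → s ℤ.≤ i → ∃[ m ] i ≡ s ℤ.+ + m
    distance i s s≤i = ℤ.∣ i ℤ.- s ∣ , ≡.sym (≡.trans
      (≡.cong (ℤ._+_ s) (ℤ.0≤i⇒+∣i∣≡i (ℤ.i≤j⇒0≤j-i s≤i)))
      (≡.trans (ℤ.+-comm s (i ℤ.- s))
      (≡.trans (ℤ.+-assoc i (ℤ.- s) s)
      (≡.trans (≡.cong (ℤ._+_ i) (ℤ.+-inverseˡ s)) (ℤ.+-identityʳ i)))))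

  O⇒noPrincipalPart : ∀ z → ∣ z ∣≤q^ (+ 0) → ∀ i → i ℤ.< + 0 → coeff z i F.≈ F.0#
  O⇒noPrincipalPart z ∣z∣≤1 i i<0 with i ℤ.<? start z
  ... | yes i<s = vanishes z i i<s
  ... | no  i≮s with distance i (start z) (ℤ.≮⇒≥ i≮s)
  ...   | m , ≡.refl with search z (suc m)
  ...     | inj₁ below = below i (ℤ.+-monoʳ-< (start z) (ℤ.+<+ (ℕ.n<1+n m)))
  ...     | inj₂ (n , n<1+i , ord) with n ℤ.≤? i
  ...       | yes n≤i = ⊥-elim (ℤ.<⇒≱ (ℤ.neg-mono-< (ℤ.≤-<-trans n≤i i<0)) (∣z∣≤1 n ord))
  ...       | no  n≰i = proj₁ ord i (ℤ.≰⇒> n≰i)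

  noPrincipalPart⇒O : ∀ z → (∀ i → i ℤ.< + 0 → coeff z i F.≈ F.0#) → ∣ z ∣≤q^ (+ 0)
  noPrincipalPart⇒O z below n (_ , ≉0) with n ℤ.<? + 0
  ... | yes n<0 = ⊥-elim (≉0 (below n n<0))
  ... | no  n≮0 = ℤ.neg-mono-≤ (ℤ.≮⇒≥ n≮0)

  _+ᴼ_ : O → O → O
  (z , z∈) +ᴼ (w , w∈) = (z +ᴷ w) , noPrincipalPart⇒O (z +ᴷ w) λ i i<0 → F.trans
    (F.+-cong (O⇒noPrincipalPart z z∈ i i<0) (O⇒noPrincipalPart w w∈ i i<0))
    (F.+-identityˡ F.0#)

  _·ᴼ_ : F.Carrier → O → O
  α ·ᴼ (z , z∈) = (α · z) , noPrincipalPart⇒O (α · z) λ i i<0 → F.trans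
    (F.*-congˡ (O⇒noPrincipalPart z z∈ i i<0)) (F.zeroʳ α)

  ∣X∣≡q^-1 : ∣ X ∣≡q^- (+ 1)
  ∣X∣≡q^-1 = vanishes X , 1≉0
    where
    open HeytingProperties F.heytingCommutativeRing using (1#0)
    open HeytingField F.heytingField using (tight)
    1≉0 : ¬ (F.1# F.≈ F.0#)
    1≉0 1≈0 = proj₂ (tight F.1# F.0#) 1≈0 1#0

-- A non-Archimedean absolute value, given by its logarithm to base q on
-- the elements apart from 0; |0| = 0.  Rational exponents suffice because
-- the value group of K̄ and of its completion is q^ℚ.  The base q is fixed
-- by the requirement that K, with |x| = q^(-1), embeds isometrically.
record ValuedField c ℓ₁ ℓ₂ : Set (lsuc (c ⊔ ℓ₁ ⊔ ℓ₂)) where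
  field
    heytingField : HeytingField c ℓ₁ ℓ₂

  open Field heytingField public

  field
    log      : ∀ z → z # 0# → ℚ
    log-cong : ∀ {z w} → z ≈ w → ∀ z#0 w#0 → log z z#0 ≡ log w w#0
    log-*    : ∀ z w z#0 w#0 zw#0 → log (z * w) zw#0 ≡ log z z#0 ℚ.+ log w w#0
    log-+    : ∀ z w z+w#0 →
               (Σ[ z#0 ∈ z # 0# ] log (z + w) z+w#0 ℚ.≤ log z z#0) ⊎
               (Σ[ w#0 ∈ w # 0# ] log (z + w) z+w#0 ℚ.≤ log w w#0)

  q^_·∣_∣≤q^_ : ℚ → Carrier → ℚ → Set ℓ₂
  q^ e ·∣ z ∣≤q^ r = ∀ z#0 → e ℚ.+ log z z#0 ℚ.≤ r

  ∣_∣≤q^_ : Carrier → ℚ → Set ℓ₂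
  ∣ z ∣≤q^ r = ∀ z#0 → log z z#0 ℚ.≤ r

  -- In limits, ε > 0 ranges over the powers q^r, r ∈ ℚ.

  infix 4 _⟶_
  _⟶_ : (ℕ → Carrier) → Carrier → Set ℓ₂
  s ⟶ l = ∀ r → ∃[ N ] ∀ n → N ℕ.≤ n → ∣ s n - l ∣≤q^ r

  q^_·∣_∣⟶0 : (ℕ → ℚ) → (ℕ → Carrier) → Set ℓ₂
  q^ e ·∣ s ∣⟶0 = ∀ r → ∃[ N ] ∀ n → N ℕ.≤ n → q^ e n ·∣ s n ∣≤q^ r

  Cauchy : (ℕ → Carrier) → Set ℓ₂
  Cauchy s = ∀ r → ∃[ N ] ∀ m n → N ℕ.≤ m → N ℕ.≤ n → ∣ s m - s n ∣≤q^ r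

  Complete : Set (c ⊔ ℓ₂)
  Complete = ∀ s → Cauchy s → ∃[ l ] s ⟶ l

module _ (𝐅 : FiniteField f f₁ f₂) (K̄ : ValuedField c ℓ₁ ℓ₂) where
  private
    module F = FiniteField 𝐅
    module K̄ = ValuedField K̄
  open LaurentSeries 𝐅

  record IsAlgebraicClosure (ι : K → K̄.Carrier) : Set (f ⊔ f₁ ⊔ c ⊔ ℓ₁ ⊔ ℓ₂) where
    open RingMorphisms rawRing (CommutativeRing.rawRing K̄.commutativeRing)
    field
      isRingMonomorphism  : IsRingMonomorphism ι
      isometric           : ∀ z n → ∣ z ∣≡q^- n →
                            Σ[ ιz#0 ∈ ι z K̄.# K̄.0# ] K̄.log (ι z) ιz#0 ≡ (ℤ.- n) ℚ./ 1
      algebraic           : ∀ w → ∃[ n ] Σ[ a ∈ Vec K n ]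
                            Any (λ aᵢ → ι aᵢ K̄.# K̄.0#) a × K̄.eval (Vec.map ι a) w K̄.≈ K̄.0#
      algebraicallyClosed : ∀ {n} (a : Vec K̄.Carrier (suc (suc n))) → Vec.last a K̄.# K̄.0# →
                            ∃[ w ] K̄.eval a w K̄.≈ K̄.0#

record IsCompletion (A : ValuedField c ℓ₁ ℓ₂) (B : ValuedField c′ ℓ₁′ ℓ₂′)
                    (j : ValuedField.Carrier A → ValuedField.Carrier B)
                    : Set (c ⊔ ℓ₁ ⊔ ℓ₂ ⊔ c′ ⊔ ℓ₁′ ⊔ ℓ₂′) where
  private
    module A = ValuedField A
    module B = ValuedField B
  open RingMorphisms (CommutativeRing.rawRing A.commutativeRing)
                     (CommutativeRing.rawRing B.commutativeRing)
  field
    isRingMonomorphism : IsRingMonomorphism j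
    isometric          : ∀ z z#0 →
                         Σ[ jz#0 ∈ j z B.# B.0# ] B.log (j z) jz#0 ≡ A.log z z#0
    dense              : ∀ w r → ∃[ z ] B.∣ w B.- j z ∣≤q^ r
    complete           : B.Complete

record CompletedAlgebraicClosure (𝐅 : FiniteField f f₁ f₂) c ℓ₁ ℓ₂ c′ ℓ₁′ ℓ₂′
       : Set (f ⊔ f₁ ⊔ lsuc (c ⊔ ℓ₁ ⊔ ℓ₂ ⊔ c′ ⊔ ℓ₁′ ⊔ ℓ₂′)) where
  open LaurentSeries 𝐅 using (K)
  field
    K̄                  : ValuedField c ℓ₁ ℓ₂
    K̄c                 : ValuedField c′ ℓ₁′ ℓ₂′
    K→K̄                : K → ValuedField.Carrier K̄
    K̄→K̄c               : ValuedField.Carrier K̄ → ValuedField.Carrier K̄c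
    isAlgebraicClosure : IsAlgebraicClosure 𝐅 K̄ K→K̄
    isCompletion       : IsCompletion K̄ K̄c K̄→K̄c

module Carlitz (𝐅 : FiniteField f f₁ f₂)
               (𝐊 : CompletedAlgebraicClosure 𝐅 c ℓ₁ ℓ₂ c′ ℓ₁′ ℓ₂′) where
  private
    module F = FiniteField 𝐅
    module IsAC = IsAlgebraicClosure
    module IsC = IsCompletion
  open F using (q)
  open CompletedAlgebraicClosure 𝐊
  open LaurentSeries 𝐅 using (K; O; ⌊_⌋; O-setoid; _+ᴼ_; _·ᴼ_; const; X; ∣X∣≡q^-1)
  open ValuedField K̄c hiding (Carrier; q^_·∣_∣⟶0)
  open ValuedField K̄c public using (Carrier; q^_·∣_∣⟶0)

  ι : K → Carrier
  ι z = K̄→K̄c (K→K̄ z)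

  x : Carrier
  x = ι X

  [_] : ℕ → Carrier
  [ i ] = x ^ (q ℕ.^ i) - x

  D : ℕ → Carrier
  D i = ∏< i λ k → [ i ℕ.∸ k ] ^ (q ℕ.^ k)

  private
    open HeytingField heytingField using (#-sym; invertible⇒#)
    open HeytingProperties heytingCommutativeRing using (1#0; x#0y#0→xy#0; #-congʳ; x-0≈x)

    #⇒-#0 : ∀ {a b} → a # b → a - b # 0#
    #⇒-#0 {a} {b} a#b with #⇒invertible a#b
    ... | y , yab , aby = invertible⇒# (y , trans (*-congˡ (x-0≈x _)) yab , trans (*-congʳ (x-0≈x _)) aby)

    -#0⇒# : ∀ {a b} → a - b # 0# → a # b
    -#0⇒# a-b#0 with #⇒invertible a-b#0
    ... | y , l , r = invertible⇒# (y , trans (*-congˡ (sym (x-0≈x _))) l , trans (*-congʳ (sym (x-0≈x _))) r)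

    ^-#0 : ∀ {z} n → z # 0# → z ^ n # 0#
    ^-#0 zero    _   = 1#0
    ^-#0 (suc n) z#0 = x#0y#0→xy#0 z#0 (^-#0 n z#0)

    ∏<-#0 : ∀ n g → (∀ k → k ℕ.< n → g k # 0#) → ∏< n g # 0#
    ∏<-#0 zero    g _  = 1#0
    ∏<-#0 (suc n) g nz = x#0y#0→xy#0 (nz 0 (s≤s z≤n)) (∏<-#0 n (g ∘ suc) λ k k<n → nz (suc k) (s≤s k<n))

    -1ℚ = (ℤ.- + 1) ℚ./ 1

    x#0×log : Σ[ x#0 ∈ x # 0# ] log x x#0 ≡ -1ℚ
    x#0×log with IsAC.isometric isAlgebraicClosure X (+ 1) ∣X∣≡q^-1
    ... | nz , eq with IsC.isometric isCompletion _ nz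
    ...   | nz′ , eq′ = nz′ , ≡.trans eq′ eq

    x#0 = proj₁ x#0×log

    log-x^ : ∀ k nz → log (x ^ suc k) nz ℚ.≤ -1ℚ
    log-x^ zero    nz = ℚ.≤-reflexive (≡.trans (log-cong (*-identityʳ x) nz x#0) (proj₂ x#0×log))
    log-x^ (suc k) nz = begin
      log (x * x ^ suc k) nz          ≡⟨ log-* x (x ^ suc k) x#0 nz′ nz ⟩
      log x x#0 ℚ.+ log (x ^ suc k) nz′ ≤⟨ ℚ.+-mono-≤ (ℚ.≤-reflexive (proj₂ x#0×log)) (log-x^ k nz′) ⟩
      -1ℚ ℚ.+ -1ℚ                     ≤⟨ ℚ.*≤* (ℤ.-≤- z≤n) ⟩
      -1ℚ                             ∎
      where
      open ℚ.≤-Reasoning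
      nz′ = ^-#0 (suc k) x#0

    log-x^2+ : ∀ k nz → log (x ^ suc (suc k)) nz ℚ.< -1ℚ
    log-x^2+ k nz = begin-strict
      log (x * x ^ suc k) nz          ≡⟨ log-* x (x ^ suc k) x#0 nz′ nz ⟩
      log x x#0 ℚ.+ log (x ^ suc k) nz′ ≤⟨ ℚ.+-mono-≤ (ℚ.≤-reflexive (proj₂ x#0×log)) (log-x^ k nz′) ⟩
      -1ℚ ℚ.+ -1ℚ                     <⟨ ℚ.*<* (ℤ.-<- (s≤s z≤n)) ⟩
      -1ℚ                             ∎
      where
      open ℚ.≤-Reasoning
      nz′ = ^-#0 (suc k) x#0

    x^n-x#0 : ∀ n → 1 ℕ.< n → x ^ n - x # 0#
    x^n-x#0 (suc (suc k)) _ = #⇒-#0 (#-sym x#x^n)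
      where
      y = x ^ suc (suc k)
      y+x-y≈x : y + (x - y) ≈ x
      y+x-y≈x = trans (+-comm y (x - y)) (trans (+-assoc x (- y) y)
                (trans (+-congˡ (-‿inverseˡ y)) (+-identityʳ x)))
      sum#0 = #-congʳ (sym y+x-y≈x) x#0
      x#x^n : x # y
      x#x^n with log-+ y (x - y) sum#0
      ... | inj₂ (nz , _)  = -#0⇒# nz
      ... | inj₁ (nz , le) = ⊥-elim (ℚ.<-irrefl ≡.refl (ℚ.<-≤-trans (log-x^2+ k nz) (ℚ.≤-trans
            (ℚ.≤-reflexive (≡.trans (≡.sym (proj₂ x#0×log)) (log-cong (sym y+x-y≈x) x#0 sum#0))) le)))
    x^n-x#0 (suc zero) (s≤s ())

    1<q^ : ∀ i → 0 ℕ.< i → 1 ℕ.< q ℕ.^ i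
    1<q^ (suc i) _ = ℕ.<-≤-trans F.1<q (ℕ.m≤m*n q (q ℕ.^ i) {{ℕ.m^n≢0 q i {{ℕ.>-nonZero (ℕ.<-trans (s≤s z≤n) F.1<q)}}}})

  D#0 : ∀ i → D i # 0#
  D#0 i = ∏<-#0 i _ λ k k<i → ^-#0 (q ℕ.^ k) (x^n-x#0 _ (1<q^ (i ℕ.∸ k) (ℕ.m<n⇒0<n∸m k<i)))

  -- All m ∈ 𝐅[x] with deg m < i, each occurring once.
  polynomials : ∀ i → List (Vec F.Carrier i)
  polynomials zero    = [] ∷ []
  polynomials (suc i) = cartesianProductWith _∷_ F.elements (polynomials i)

  e : ℕ → Carrier → Carrier
  e zero      t = t
  e i@(suc _) t = foldr _*_ 1# (map (λ m → t - eval (Vec.map (ι ∘ const) m) x) (polynomials i))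

  f̂ : ℕ → Carrier → Carrier
  f̂ i t = inverse (D#0 i) * e i t

  record C₀ : Set (f ⊔ f₁ ⊔ c′ ⊔ ℓ₁′ ⊔ ℓ₂′) where
    field
      function : Func O-setoid setoid
    open Func function public renaming (to to ⟦_⟧)
    field
      additive    : ∀ t₁ t₂ → ⟦ t₁ +ᴼ t₂ ⟧ ≈ ⟦ t₁ ⟧ + ⟦ t₂ ⟧
      homogeneous : ∀ α t → ⟦ α ·ᴼ t ⟧ ≈ ι (const α) * ⟦ t ⟧
      continuous  : ∀ t r → ∃[ δ ] ∀ s →
                    ∣ ι ⌊ s ⌋ - ι ⌊ t ⌋ ∣≤q^ δ → ∣ ⟦ s ⟧ - ⟦ t ⟧ ∣≤q^ r
  open C₀ using (⟦_⟧)

  -- f̂ₙ takes arguments in K̄c ⊇ O, so O enters through ι.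
  record _IsCarlitzExpansionOf_ (a : ℕ → Carrier) (u : C₀) : Set (f ⊔ f₁ ⊔ ℓ₂′) where
    field
      null    : a ⟶ 0#
      uniform : ∀ r → ∃[ N ] ∀ n → N ℕ.≤ n → ∀ t →
                ∣ ∑< n (λ i → a i * f̂ i (ι ⌊ t ⌋)) - ⟦ u ⟧ t ∣≤q^ r

  _∈A : C₀ → Set (f ⊔ f₁ ⊔ c′ ⊔ ℓ₂′)
  u ∈A = ∃[ a ] (a ⟶ 0#) × (∀ t → (λ N → ∑< N λ n → a n * ι ⌊ t ⌋ ^ (q ℕ.^ n)) ⟶ ⟦ u ⟧ t)

  q^n/[q-1] : ℕ → ℚ
  q^n/[q-1] n = + (q ℕ.^ n) ℚ./ (q ℕ.∸ 1)

-- By eₙ₊₁(t) = ∏_α eₙ(t − α xⁿ) = eₙ(t)^q − eₙ(xⁿ)^(q−1) eₙ(t), the polynomials eₙ are linear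
-- combinations of the t^(qⁱ), i ≤ n, and conversely, with all coefficients of absolute value ≤ 1.
-- Write cₙ fₙ = dₙ eₙ.  As |Dₙ| = q^(−(qⁿ−1)/(q−1)), the condition on c says exactly that dₙ → 0.
-- If dₙ → 0, the double series for u may be rearranged into powers t^(qⁱ).  Conversely, if
-- u = ∑ aₙ t^(qⁿ), expanding the powers in the eᵢ gives coefficients bounded by
-- sup_{n ≥ i} |aₙ|; evaluating at t = xʲ for j = 0, 1, …, where eᵢ vanishes for i > j, shows
-- that these coefficients are the dᵢ.
module Submission where

open import Algebra.Apartness using (HeytingField)
import Algebra.Apartness.Properties.HeytingCommutativeRing as HeytingProperties
open import Algebra.Morphism.Structures using (module RingMorphisms)
import Algebra.Properties.CommutativeMonoid.Sum as BigOp
import Algebra.Properties.CommutativeSemigroup as SemigroupProperties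
import Algebra.Properties.CommutativeSemiring.Binomial as Binomial
import Algebra.Properties.CommutativeSemiring.Exp as CommutativeExp
import Algebra.Properties.Group as GroupProperties
import Algebra.Properties.Ring as RingProperties
import Algebra.Properties.Semiring.Exp as Exp
import Algebra.Properties.Semiring.Mult as Mult
import Algebra.Properties.Semiring.Sum as SemiringSum
open import Data.Empty using (⊥-elim)
open import Data.Fin using (Fin; zero; suc; toℕ; fromℕ; inject₁; punchIn)
open import Data.Fin.Permutation using (Permutation; permutation; _⟨$⟩ʳ_)
import Data.Fin.Properties as Fin
open import Data.Integer as ℤ using (ℤ; +_; -[1+_])
import Data.Integer.Properties as ℤ
open import Data.List using (List; []; _∷_; foldr; map; tabulate; cartesianProductWith; _++_; allFin)
import Data.List.Properties as List
open import Data.Nat as ℕ using (ℕ; zero; suc; NonZero; z≤n; s≤s; _<_; _!; _⊔_)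
open import Data.Nat.Combinatorics using (_C_; nCn≡1; nCk≡nC[n∸k]; k![n∸k]!∣n!)
open import Data.Nat.Combinatorics.Specification using (nCk≡n!/k![n-k]!)
open import Data.Nat.DivMod using (m/n*n≡m)
import Data.Nat.Divisibility as ℕ
open import Data.Nat.Induction using (<-rec)
open import Data.Nat.Primality using (Prime; prime⇒nonTrivial; euclidsLemma; ¬prime[0])
open import Data.Nat.Properties using (_!*_!≢0)
import Data.Nat.Properties as ℕ
open import Data.Nat.Tactic.RingSolver using (solve-∀)
open import Data.Product using (Σ-syntax; ∃-syntax; _×_; _,_; proj₁; proj₂)
open import Data.Rational as ℚ using (ℚ; 0ℚ; 1ℚ)
import Data.Rational.Properties as ℚ
import Data.Rational.Unnormalised as ℚᵘ
import Data.Rational.Unnormalised.Properties as ℚᵘ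
open import Data.Sum using (_⊎_; inj₁; inj₂; [_,_]′)
open import Data.Vec as Vec using (Vec; []; _∷_; _∷ʳ_)
open import Function using (_∘_; id; Inverse)
open import Function.Bundles using (_⇔_; mk⇔)
open import Level using (Level)
open import Relation.Binary using (tri<; tri≈; tri>)
open import Relation.Binary.PropositionalEquality as ≡ using (_≡_; _≢_)
import Relation.Binary.Reasoning.Setoid as SetoidReasoning
open import Relation.Nullary using (¬_; yes; no)
open import Defs

-- The product over α in the recursion collapses only because eₙ is 𝐅-linear, and linearity is read
-- off from the expansion of eₙ in the t^(qⁱ). Recursion and expansion therefore advance in a single
-- induction. The collapse itself is ∏ (z - α) = z^q - z, homogenised with w = eₙ(xⁿ). This divides
-- by w, and since equality with 0 in K̄c is not decidable, w must be shown apart from 0 by a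
-- positive argument: ultrametric dominance, one coefficient at a time. In the converse direction,
-- isolating dⱼ means dividing by eⱼ(xʲ), which costs a factor depending on j. Hence the decay of dⱼ
-- cannot be taken from that division. It serves only to show, for each j separately, that dⱼ is the
-- limit of the j-th coefficients of the finite sums. The bound uniform in j comes from the
-- integrality of the change of basis.

-- Binomial coefficients modulo a prime.

prime∤! : ∀ {p k} → Prime p → k < p → p ℕ.∤ k !
prime∤! {p} {zero}  pr _ = ℕ.>⇒∤ {1} {p} (ℕ.nonTrivial⇒n>1 p {{prime⇒nonTrivial pr}})
prime∤! {p} {suc k} pr k<p d with euclidsLemma (suc k) (k !) pr d
... | inj₁ p∣1+k = ℕ.>⇒∤ k<p p∣1+k
... | inj₂ p∣k!  = prime∤! pr (ℕ.<-trans (ℕ.n<1+n k) k<p) p∣k!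

-- p divides p! = (p C k) · k! · (p - k)!, and both factorials are products of numbers below p.
prime∣C : ∀ {p k} → Prime p → 0 < k → k < p → p ℕ.∣ p C k
prime∣C {suc p′} {k} pr 0<k k<p = split (euclidsLemma (p C k) (k ! ℕ.* (p ℕ.∸ k) !) pr p∣)
  where
  p = suc p′
  instance _ = k !* (p ℕ.∸ k) !≢0
  C*≡p! : (p C k) ℕ.* (k ! ℕ.* (p ℕ.∸ k) !) ≡ p !
  C*≡p! = ≡.trans (≡.cong (ℕ._* (k ! ℕ.* (p ℕ.∸ k) !)) (nCk≡n!/k![n-k]! (ℕ.<⇒≤ k<p)))
                  (m/n*n≡m (k![n∸k]!∣n! (ℕ.<⇒≤ k<p)))
  p∣ : p ℕ.∣ (p C k) ℕ.* (k ! ℕ.* (p ℕ.∸ k) !)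
  p∣ = ≡.subst (p ℕ.∣_) (≡.sym C*≡p!) (ℕ.m∣m*n (p′ !))
  split : p ℕ.∣ (p C k) ⊎ p ℕ.∣ k ! ℕ.* (p ℕ.∸ k) ! → p ℕ.∣ p C k
  split (inj₁ d) = d
  split (inj₂ d) with euclidsLemma (k !) ((p ℕ.∸ k) !) pr d
  ... | inj₁ d′ = ⊥-elim (prime∤! pr k<p d′)
  ... | inj₂ d′ = ⊥-elim (prime∤! pr (ℕ.∸-monoʳ-< 0<k (ℕ.<⇒≤ k<p)) d′)
prime∣C {zero} pr = ⊥-elim (¬prime[0] pr)

-- Rational exponents and the geometric sum.

-- `ℚ._/_` reduces fractions to lowest terms, so inequalities between them are proved by
-- cross-multiplication on unnormalised representatives and carried over by this lemma.
fromℚᵘ-mono-≤ : ∀ {u v} → u ℚᵘ.≤ v → ℚ.fromℚᵘ u ℚ.≤ ℚ.fromℚᵘ v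
fromℚᵘ-mono-≤ {u} {v} u≤v = ℚ.toℚᵘ-cancel-≤ (ℚᵘ.≤-respˡ-≃ (ℚᵘ.≃-sym (ℚ.toℚᵘ-fromℚᵘ u))
  (ℚᵘ.≤-respʳ-≃ (ℚᵘ.≃-sym (ℚ.toℚᵘ-fromℚᵘ v)) u≤v))

fromNat : ℕ → ℚ
fromNat n = + n ℚ./ 1

fromNat-+ : ∀ m n → fromNat (m ℕ.+ n) ≡ fromNat m ℚ.+ fromNat n
fromNat-+ m n = ℚ.toℚᵘ-injective (ℚᵘ.≃-trans (ℚ.toℚᵘ-fromℚᵘ (u (m ℕ.+ n)))
  (ℚᵘ.≃-trans (ℚᵘ.*≡* (≡.cong (ℤ._* + 1) (≡.sym (≡.cong₂ ℤ._+_ (ℤ.*-identityʳ (+ m)) (ℤ.*-identityʳ (+ n))))))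
  (ℚᵘ.≃-trans (ℚᵘ.+-cong (ℚᵘ.≃-sym (ℚ.toℚᵘ-fromℚᵘ (u m))) (ℚᵘ.≃-sym (ℚ.toℚᵘ-fromℚᵘ (u n))))
  (ℚᵘ.≃-sym (ℚ.toℚᵘ-homo-+ (fromNat m) (fromNat n))))))
  where
  u : ℕ → ℚᵘ.ℚᵘ
  u k = ℚᵘ.mkℚᵘ (+ k) 0

-- The fraction is `s` + 1/`d`. For `d` = q - 1 and `s` = 1 + q + ... + q^(n-1) it is the exponent
-- qⁿ/(q - 1); integer bounds suffice, because a bounded factor does not affect convergence to 0.
[1+d*s]/d-bounds : ∀ d .{{_ : NonZero d}} s →
  (fromNat s ℚ.≤ + (1 ℕ.+ d ℕ.* s) ℚ./ d) × (+ (1 ℕ.+ d ℕ.* s) ℚ./ d ℚ.≤ fromNat (1 ℕ.+ s))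
[1+d*s]/d-bounds d@(suc k) s =
  fromℚᵘ-mono-≤ {ℚᵘ.mkℚᵘ (+ s) 0} {ℚᵘ.mkℚᵘ (+ n) k} (ℚᵘ.*≤* (≡.subst₂ ℤ._≤_ (ℤ.pos-* s d) (≡.sym (ℤ.*-identityʳ (+ n)))
    (ℤ.+≤+ (≡.subst (ℕ._≤ n) (ℕ.*-comm d s) (ℕ.n≤1+n _))))) ,
  fromℚᵘ-mono-≤ {ℚᵘ.mkℚᵘ (+ n) k} {ℚᵘ.mkℚᵘ (+ (1 ℕ.+ s)) 0} (ℚᵘ.*≤* (≡.subst₂ ℤ._≤_ (≡.sym (ℤ.*-identityʳ (+ n))) (ℤ.pos-* (1 ℕ.+ s) d)
    (ℤ.+≤+ (s≤s (ℕ.≤-trans (ℕ.≤-reflexive (ℕ.*-comm d s)) (ℕ.m≤n+m (s ℕ.* d) k))))))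
  where n = 1 ℕ.+ d ℕ.* s

sumℕ : ℕ → (ℕ → ℕ) → ℕ
sumℕ zero    s = 0
sumℕ (suc n) s = s 0 ℕ.+ sumℕ n (s ∘ suc)

sumℕ-*ˡ : ∀ n m s → sumℕ n (λ k → m ℕ.* s k) ≡ m ℕ.* sumℕ n s
sumℕ-*ˡ zero    m s = ≡.sym (ℕ.*-zeroʳ m)
sumℕ-*ˡ (suc n) m s = ≡.trans (≡.cong (m ℕ.* s 0 ℕ.+_) (sumℕ-*ˡ n m (s ∘ suc))) (≡.sym (ℕ.*-distribˡ-+ m (s 0) _))

geometric : ∀ d n → suc d ℕ.^ n ≡ 1 ℕ.+ d ℕ.* sumℕ n (suc d ℕ.^_)
geometric d zero    = ≡.cong suc (≡.sym (ℕ.*-zeroʳ d))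
geometric d (suc n) = ≡.trans (≡.cong (suc d ℕ.*_) (geometric d n))
  (≡.trans (expand d (sumℕ n (suc d ℕ.^_)))
  (≡.cong (λ s → 1 ℕ.+ d ℕ.* (1 ℕ.+ s)) (≡.sym (sumℕ-*ˡ n (suc d) (suc d ℕ.^_)))))
  where
  expand : ∀ d s → suc d ℕ.* (1 ℕ.+ d ℕ.* s) ≡ 1 ℕ.+ d ℕ.* (1 ℕ.+ suc d ℕ.* s)
  expand = solve-∀

-- Algebra in a field with apartness.

module FieldProperties {c ℓ₁ ℓ₂} (𝔽 : HeytingField c ℓ₁ ℓ₂) where
  open Field 𝔽 hiding (zero)
  open HeytingField 𝔽 using (tight; invertible⇒#)
  open HeytingProperties heytingCommutativeRing public using (1#0; x-0≈x; x#0y#0→xy#0; #-congʳ)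
  open RingProperties ring public
  open Exp semiring public using (^-congˡ; ^-congʳ; ^-assocʳ)
  open CommutativeExp commutativeSemiring public using (^-distrib-*)
  open Mult semiring public using (×-congʳ; ×-congˡ; ×-homo-1; ×-assoc-*; ×1-homo-*)
    renaming (_×_ to _⊗_)
  open SetoidReasoning setoid
  module Sum = SemiringSum semiring
  module Product = BigOp *-commutativeMonoid
  module +P = SemigroupProperties +-commutativeSemigroup
  module *P = SemigroupProperties *-commutativeSemigroup

  ¬#0⇒≈0 : ∀ {z} → ¬ z # 0# → z ≈ 0#
  ¬#0⇒≈0 = proj₁ (tight _ _)

  ≈0⇒¬#0 : ∀ {z} → z ≈ 0# → ¬ z # 0#
  ≈0⇒¬#0 = proj₂ (tight _ _)

  inverseʳ : ∀ {z} (z#0 : z # 0#) → z * inverse z#0 ≈ 1#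
  inverseʳ {z} z#0 = trans (*-congʳ (sym (x-0≈x z))) (proj₂ (proj₂ (#⇒invertible z#0)))

  inverseˡ : ∀ {z} (z#0 : z # 0#) → inverse z#0 * z ≈ 1#
  inverseˡ z#0 = trans (*-comm _ _) (inverseʳ z#0)

  *≈1⇒#0 : ∀ {z w} → z * w ≈ 1# → z # 0#
  *≈1⇒#0 {z} {w} zw≈1 = invertible⇒#
    (w , trans (*-comm _ _) z-0*w≈1 , z-0*w≈1)
    where z-0*w≈1 = trans (*-congʳ (x-0≈x z)) zw≈1

  -- Apartness from 0 amounts to invertibility, and w · (zw)⁻¹ is an inverse of z.
  *#0⇒#0ˡ : ∀ {z w} → z * w # 0# → z # 0#
  *#0⇒#0ˡ zw#0 = *≈1⇒#0 (trans (sym (*-assoc _ _ _)) (inverseʳ zw#0))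

  *#0⇒#0ʳ : ∀ {z w} → z * w # 0# → w # 0#
  *#0⇒#0ʳ zw#0 = *#0⇒#0ˡ (#-congʳ (*-comm _ _) zw#0)

  -#0 : ∀ {z} → z # 0# → - z # 0#
  -#0 {z} z#0 = *#0⇒#0ˡ {w = - 1#} (#-congʳ (sym z*) z#0)
    where
    z* : - z * - 1# ≈ z
    z* = trans (*-comm _ _) (trans (-1*x≈-x (- z)) (-‿involutive z))

  ^-#0 : ∀ {z} n → z # 0# → z ^ n # 0#
  ^-#0 zero    _   = 1#0
  ^-#0 (suc n) z#0 = x#0y#0→xy#0 z#0 (^-#0 n z#0)

  -- By tightness it is enough to refute `w # 0#`, so no decision about w is required.
  *-cancelˡ-≈0 : ∀ {z w} → z # 0# → z * w ≈ 0# → w ≈ 0#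
  *-cancelˡ-≈0 z#0 zw≈0 = ¬#0⇒≈0 λ w#0 → ≈0⇒¬#0 zw≈0 (x#0y#0→xy#0 z#0 w#0)

  0^n≈0 : ∀ n .{{_ : NonZero n}} → 0# ^ n ≈ 0#
  0^n≈0 (suc n) = zeroˡ _

  a-b+b≈a : ∀ a b → (a - b) + b ≈ a
  a-b+b≈a a b = trans (+-assoc _ _ _) (trans (+-congˡ (-‿inverseˡ b)) (+-identityʳ a))

  a+b-b≈a : ∀ a b → (a + b) - b ≈ a
  a+b-b≈a a b = trans (+-assoc _ _ _) (trans (+-congˡ (-‿inverseʳ b)) (+-identityʳ a))

  a-b+[b-c]≈a-c : ∀ a b c → (a - b) + (b - c) ≈ a - c
  a-b+[b-c]≈a-c a b c = trans (sym (+-assoc _ _ _)) (+-congʳ (a-b+b≈a a b))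

  [a+b]-[c+d]≈[a-c]+[b-d] : ∀ a b c d → (a + b) - (c + d) ≈ (a - c) + (b - d)
  [a+b]-[c+d]≈[a-c]+[b-d] a b c d = trans (+-congˡ (sym (-‿+-comm c d))) (+P.interchange a b (- c) (- d))

  -- Sums and products

  ∑<-cong : ∀ n {f g} → (∀ i → i < n → f i ≈ g i) → ∑< n f ≈ ∑< n g
  ∑<-cong zero    _  = refl
  ∑<-cong (suc n) eq = +-cong (eq 0 (s≤s z≤n)) (∑<-cong n λ i i<n → eq (suc i) (s≤s i<n))

  ∑<-0 : ∀ n → ∑< n (λ _ → 0#) ≈ 0#
  ∑<-0 = Sum.sum-replicate-zero

  ∑<-+ : ∀ n f g → ∑< n (λ i → f i + g i) ≈ ∑< n f + ∑< n g
  ∑<-+ n f g = Sum.∑-distrib-+ {n} (f ∘ toℕ) (g ∘ toℕ)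

  ∑<-*ˡ : ∀ n z g → z * ∑< n g ≈ ∑< n (λ i → z * g i)
  ∑<-*ˡ n z g = Sum.*-distribˡ-sum {n} z (g ∘ toℕ)

  ∑<-*ʳ : ∀ n z g → ∑< n g * z ≈ ∑< n (λ i → g i * z)
  ∑<-*ʳ n z g = Sum.*-distribʳ-sum {n} z (g ∘ toℕ)

  ∑<-neg : ∀ n g → - ∑< n g ≈ ∑< n (λ i → - g i)
  ∑<-neg n g = trans (sym (-1*x≈-x _)) (trans (∑<-*ˡ n (- 1#) g) (∑<-cong n λ i _ → -1*x≈-x (g i)))

  ∑<-minus : ∀ n f g → ∑< n (λ i → f i - g i) ≈ ∑< n f - ∑< n g
  ∑<-minus n f g = trans (∑<-+ n f (λ i → - g i)) (+-congˡ (sym (∑<-neg n g)))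

  ∑<-comm : ∀ m n (f : ℕ → ℕ → Carrier) →
            ∑< m (λ i → ∑< n (f i)) ≈ ∑< n (λ j → ∑< m λ i → f i j)
  ∑<-comm m n f = Sum.∑-comm {m} {n} λ i j → f (toℕ i) (toℕ j)

  ∑<-last : ∀ n g → ∑< (suc n) g ≈ ∑< n g + g n
  ∑<-last zero    g = +-comm _ _
  ∑<-last (suc n) g = trans (+-congˡ (∑<-last n (g ∘ suc))) (sym (+-assoc _ _ _))

  ∏ : ∀ {a} {A : Set a} → List A → (A → Carrier) → Carrier
  ∏ xs g = foldr _*_ 1# (map g xs)

  private
    variable
      a b : Level
      A : Set a
      B : Set b

  ∏-cong : ∀ (xs : List A) {f g} → (∀ z → f z ≈ g z) → ∏ xs f ≈ ∏ xs g
  ∏-cong []       _  = refl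
  ∏-cong (z ∷ xs) eq = *-cong (eq z) (∏-cong xs eq)

  ∏-map : ∀ (h : A → B) xs g → ∏ (map h xs) g ≡ ∏ xs (g ∘ h)
  ∏-map h xs g = ≡.cong (foldr _*_ 1#) (≡.sym (List.map-∘ xs))

  ∏-++ : ∀ (xs ys : List A) g → ∏ (xs ++ ys) g ≈ ∏ xs g * ∏ ys g
  ∏-++ []       ys g = sym (*-identityˡ _)
  ∏-++ (z ∷ xs) ys g = trans (*-congˡ (∏-++ xs ys g)) (sym (*-assoc _ _ _))

  ∏-1 : ∀ (xs : List A) → ∏ xs (λ _ → 1#) ≈ 1#
  ∏-1 []       = refl
  ∏-1 (_ ∷ xs) = trans (*-identityˡ _) (∏-1 xs)

  ∏-* : ∀ (xs : List A) f g → ∏ xs (λ z → f z * g z) ≈ ∏ xs f * ∏ xs g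
  ∏-* []       f g = sym (*-identityˡ _)
  ∏-* (z ∷ xs) f g = trans (*-congˡ (∏-* xs f g)) (*P.interchange _ _ _ _)

  ∏-comm : ∀ (xs : List A) (ys : List B) (f : A → B → Carrier) →
           ∏ xs (λ z → ∏ ys (f z)) ≈ ∏ ys (λ w → ∏ xs λ z → f z w)
  ∏-comm []       ys f = sym (∏-1 ys)
  ∏-comm (z ∷ xs) ys f = trans (*-congˡ (∏-comm xs ys f)) (sym (∏-* ys (f z) _))

  ∏-cartesianProductWith : ∀ {d} {D : Set d} (h : A → B → D) xs ys g →
    ∏ (cartesianProductWith h xs ys) g ≈ ∏ xs (λ z → ∏ ys (g ∘ h z))
  ∏-cartesianProductWith h []       ys g = refl
  ∏-cartesianProductWith h (z ∷ xs) ys g = trans (∏-++ (map (h z) ys) _ g)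
    (*-cong (reflexive (∏-map (h z) ys g)) (∏-cartesianProductWith h xs ys g))

  ∏-tabulate : ∀ {n} (h : Fin n → A) g → ∏ (tabulate h) g ≈ product (g ∘ h)
  ∏-tabulate {n = zero}  h g = refl
  ∏-tabulate {n = suc n} h g = *-congˡ (∏-tabulate (h ∘ suc) g)

  ∏-#0 : ∀ (xs : List A) {g} → (∀ z → g z # 0#) → ∏ xs g # 0#
  ∏-#0 []       _  = 1#0
  ∏-#0 (z ∷ xs) nz = x#0y#0→xy#0 (nz z) (∏-#0 xs nz)

  product-replicate : ∀ n z → product {n} (λ _ → z) ≈ z ^ n
  product-replicate zero    z = refl
  product-replicate (suc n) z = *-congˡ (product-replicate n z)

  -- The Frobenius map

  Additive : ℕ → Set _
  Additive n = ∀ z w → (z + w) ^ n ≈ z ^ n + w ^ n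

  additive-1 : Additive 1
  additive-1 z w = trans (*-identityʳ _) (+-cong (sym (*-identityʳ _)) (sym (*-identityʳ _)))

  additive-* : ∀ m n → Additive m → Additive n → Additive (m ℕ.* n)
  additive-* m n am an z w = begin
    (z + w) ^ (m ℕ.* n)       ≈⟨ ^-assocʳ (z + w) m n ⟨
    ((z + w) ^ m) ^ n         ≈⟨ ^-congˡ n (am z w) ⟩
    (z ^ m + w ^ m) ^ n       ≈⟨ an _ _ ⟩
    (z ^ m) ^ n + (w ^ m) ^ n ≈⟨ +-cong (^-assocʳ z m n) (^-assocʳ w m n) ⟩
    z ^ (m ℕ.* n) + w ^ (m ℕ.* n) ∎

  additive-^ : ∀ m k → Additive m → Additive (m ℕ.^ k)
  additive-^ m zero    am = additive-1
  additive-^ m (suc k) am = additive-* m (m ℕ.^ k) am (additive-^ m k am)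

  -- (-z)ⁿ is identified as the additive inverse of zⁿ rather than through the sign (-1)ⁿ, so the
  -- parity of n never enters.
  additive-neg : ∀ n .{{_ : NonZero n}} → Additive n → ∀ z → (- z) ^ n ≈ - (z ^ n)
  additive-neg n an z = +-inverseˡ-unique _ _
    (trans (sym (an (- z) z)) (trans (^-congˡ n (-‿inverseˡ z)) (0^n≈0 n)))

  additive-minus : ∀ n .{{_ : NonZero n}} → Additive n → ∀ z w → (z - w) ^ n ≈ z ^ n - w ^ n
  additive-minus n an z w = trans (an z (- w)) (+-congˡ (additive-neg n an w))

  additive-∑< : ∀ n .{{_ : NonZero n}} → Additive n → ∀ N g → ∑< N g ^ n ≈ ∑< N (λ i → g i ^ n)
  additive-∑< n an zero    g = 0^n≈0 n
  additive-∑< n an (suc N) g = trans (an _ _) (+-congˡ (additive-∑< n an N (g ∘ suc)))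

  ∣⇒⊗≈0 : ∀ {p n} → p ⊗ 1# ≈ 0# → p ℕ.∣ n → ∀ z → n ⊗ z ≈ 0#
  ∣⇒⊗≈0 {p} p≈0 (ℕ.divides k ≡.refl) z = begin
    (k ℕ.* p) ⊗ z        ≈⟨ ×-congʳ (k ℕ.* p) (*-identityˡ z) ⟨
    (k ℕ.* p) ⊗ (1# * z) ≈⟨ ×-assoc-* (k ℕ.* p) 1# z ⟨
    ((k ℕ.* p) ⊗ 1#) * z ≈⟨ *-congʳ (×1-homo-* k p) ⟩
    (k ⊗ 1# * (p ⊗ 1#)) * z ≈⟨ *-congʳ (*-congˡ p≈0) ⟩
    (k ⊗ 1# * 0#) * z    ≈⟨ *-congʳ (zeroʳ _) ⟩
    0# * z               ≈⟨ zeroˡ z ⟩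
    0#                   ∎

  -- All inner binomial coefficients are multiples of p and vanish in characteristic p; the two
  -- extreme terms remain.
  frobenius : ∀ {p} → Prime p → p ⊗ 1# ≈ 0# → Additive p
  frobenius {suc p′} pr p≈0 z w = begin
    (z + w) ^ p                          ≈⟨ Binomial.theorem commutativeSemiring p z w ⟩
    t zero + sum (t ∘ suc)               ≈⟨ +-congˡ (Sum.sum-init-last (t ∘ suc)) ⟩
    t zero + (sum (λ i → t (suc (inject₁ i))) + t (suc (fromℕ p′)))
                                         ≈⟨ +-cong first (+-cong (trans (Sum.sum-cong-≋ middle) (Sum.sum-replicate-zero p′)) final) ⟩
    w ^ p + (0# + z ^ p)                 ≈⟨ +-congˡ (+-identityˡ _) ⟩
    w ^ p + z ^ p                        ≈⟨ +-comm _ _ ⟩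
    z ^ p + w ^ p                        ∎
    where
    p = suc p′
    t = Binomial.binomialTerm commutativeSemiring z w p
    first : t zero ≈ w ^ p
    first = trans (×-congˡ {1# * w ^ p} (≡.trans (nCk≡nC[n∸k] {0} {p} z≤n) (nCn≡1 p))) (trans (×-homo-1 _) (*-identityˡ _))
    middle : ∀ i → t (suc (inject₁ i)) ≈ 0#
    middle i = ∣⇒⊗≈0 p≈0 (prime∣C pr (s≤s z≤n)
      (s≤s (≡.subst (_< p′) (≡.sym (Fin.toℕ-inject₁ i)) (Fin.toℕ<n i)))) _
    final : t (suc (fromℕ p′)) ≈ z ^ p
    final = begin
      t (suc (fromℕ p′)) ≡⟨ ≡.cong (λ k → (p C suc k) ⊗ (z ^ suc k * w ^ (p′ ℕ.∸ k))) (Fin.toℕ-fromℕ p′) ⟩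
      (p C p) ⊗ (z ^ p * w ^ (p′ ℕ.∸ p′)) ≡⟨ ≡.cong₂ (λ k l → k ⊗ (z ^ p * w ^ l)) (nCn≡1 p) (ℕ.n∸n≡0 p′) ⟩
      1 ⊗ (z ^ p * 1#)   ≈⟨ ×-homo-1 _ ⟩
      z ^ p * 1#         ≈⟨ *-identityʳ _ ⟩
      z ^ p              ∎
  frobenius {zero} pr _ = ⊥-elim (¬prime[0] pr)

  -- The map n ↦ n · 1 is multiplicative, and a power of an element apart from 0 is apart from 0.
  ^⊗1≈0⇒⊗1≈0 : ∀ p k → (p ℕ.^ k) ⊗ 1# ≈ 0# → p ⊗ 1# ≈ 0#
  ^⊗1≈0⇒⊗1≈0 p k eq = ¬#0⇒≈0 λ p#0 → ≈0⇒¬#0 (trans (sym (homo k)) eq) (^-#0 k p#0)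
    where
    homo : ∀ k → (p ℕ.^ k) ⊗ 1# ≈ (p ⊗ 1#) ^ k
    homo zero    = ×-homo-1 1#
    homo (suc k) = trans (×1-homo-* p (p ℕ.^ k)) (*-congˡ (homo k))

  -- The factor theorem

  -- The value at z of the monic polynomial of degree n with lower coefficients as.
  evalMonic : ∀ {n} → Vec Carrier n → Carrier → Carrier
  evalMonic []       z = 1#
  evalMonic (a ∷ as) z = a + z * evalMonic as z

  -- Synthetic division by z - r: the coefficients of the quotient are the intermediate Horner
  -- values at r. The leading 1 stays implicit, so a linear polynomial has quotient `[]`, the
  -- constant 1.
  quotient : ∀ {n} → Carrier → Vec Carrier (suc n) → Vec Carrier n
  quotient r (_ ∷ [])          = []
  quotient r (_ ∷ as@(_ ∷ _)) = evalMonic as r ∷ quotient r as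

  evalMonic-quotient : ∀ {n} r (as : Vec Carrier (suc n)) z →
    evalMonic as z ≈ evalMonic as r + (z - r) * evalMonic (quotient r as) z
  evalMonic-quotient r (a ∷ []) z = begin
    a + z * 1#                        ≈⟨ +-congˡ (*-congʳ (trans (+-comm _ _) (a-b+b≈a z r))) ⟨
    a + (r + (z - r)) * 1#            ≈⟨ +-congˡ (distribʳ _ _ _) ⟩
    a + (r * 1# + (z - r) * 1#)       ≈⟨ +-assoc _ _ _ ⟨
    (a + r * 1#) + (z - r) * 1#       ∎
  evalMonic-quotient r (a ∷ as@(_ ∷ _)) z = begin
    a + z * evalMonic as z            ≈⟨ +-congˡ (*-congˡ (evalMonic-quotient r as z)) ⟩
    a + z * (m + (z - r) * m′)        ≈⟨ +-congˡ (distribˡ _ _ _) ⟩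
    a + (z * m + z * ((z - r) * m′))  ≈⟨ +-congˡ (+-cong (*-congʳ (trans (+-comm _ _) (a-b+b≈a z r))) (*P.x∙yz≈y∙xz (z - r) z m′)) ⟨
    a + ((r + (z - r)) * m + (z - r) * (z * m′)) ≈⟨ +-congˡ (+-congʳ (distribʳ _ _ _)) ⟩
    a + ((r * m + (z - r) * m) + (z - r) * (z * m′)) ≈⟨ +-congˡ (+-assoc _ _ _) ⟩
    a + (r * m + ((z - r) * m + (z - r) * (z * m′))) ≈⟨ +-congˡ (+-congˡ (distribˡ _ _ _)) ⟨
    a + (r * m + (z - r) * (m + z * m′)) ≈⟨ +-assoc _ _ _ ⟨
    (a + r * m) + (z - r) * (m + z * m′) ∎
    where
    m = evalMonic as r
    m′ = evalMonic (quotient r as) z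

  -- After splitting off z - r₀, the other roots are roots of the quotient, because their
  -- differences with r₀ can be cancelled. There are as many roots as the degree, so the last
  -- quotient is the constant 1.
  evalMonic-roots : ∀ {n} (as : Vec Carrier n) (r : Fin n → Carrier) →
    (∀ i j → i ≢ j → r i - r j # 0#) → (∀ i → evalMonic as (r i) ≈ 0#) →
    ∀ z → evalMonic as z ≈ product (λ i → z - r i)
  evalMonic-roots []            r _     _    z = refl
  evalMonic-roots as@(_ ∷ _) r apart root z = begin
    evalMonic as z                     ≈⟨ evalMonic-quotient r₀ as z ⟩
    evalMonic as r₀ + (z - r₀) * evalMonic (quotient r₀ as) z
                                       ≈⟨ +-cong (root zero) (*-congˡ (evalMonic-roots (quotient r₀ as) (r ∘ suc)
                                            (λ i j i≢j → apart (suc i) (suc j) (i≢j ∘ Fin.suc-injective)) root′ z)) ⟩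
    0# + (z - r₀) * product (λ i → z - r (suc i)) ≈⟨ +-identityˡ _ ⟩
    (z - r₀) * product (λ i → z - r (suc i)) ∎
    where
    r₀ = r zero
    root′ : ∀ i → evalMonic (quotient r₀ as) (r (suc i)) ≈ 0#
    root′ i = *-cancelˡ-≈0 (apart (suc i) zero λ ()) (begin
      (r (suc i) - r₀) * evalMonic (quotient r₀ as) (r (suc i)) ≈⟨ +-identityˡ _ ⟨
      0# + _                   ≈⟨ +-congʳ (root zero) ⟨
      evalMonic as r₀ + _      ≈⟨ evalMonic-quotient r₀ as (r (suc i)) ⟨
      evalMonic as (r (suc i)) ≈⟨ root (suc i) ⟩
      0#                       ∎)

-- Ultrametric estimates.

module ValuedProperties {c ℓ₁ ℓ₂} (V : ValuedField c ℓ₁ ℓ₂) where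
  open ValuedField V hiding (zero)
  open FieldProperties heytingField
  private module ℚG = GroupProperties ℚ.+-0-group

  l+l≡0⇒l≡0 : ∀ l → l ℚ.+ l ≡ 0ℚ → l ≡ 0ℚ
  l+l≡0⇒l≡0 l eq with ℚ.<-cmp l 0ℚ
  ... | tri≈ _ l≡0 _ = l≡0
  ... | tri< l<0 _ _ = ⊥-elim (ℚ.<-irrefl eq (ℚ.+-mono-< l<0 l<0))
  ... | tri> _ _ 0<l = ⊥-elim (ℚ.<-irrefl (≡.sym eq) (ℚ.+-mono-< 0<l 0<l))

  log-1 : ∀ nz → log 1# nz ≡ 0ℚ
  log-1 nz = ℚG.identityˡ-unique _ _
    (≡.trans (≡.sym (log-* 1# 1# nz nz 1*1#0)) (log-cong (*-identityˡ 1#) 1*1#0 nz))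
    where 1*1#0 = x#0y#0→xy#0 nz nz

  -- (-1)² = 1 makes twice the logarithm 0, and ℚ has no 2-torsion.
  log-‿1 : ∀ nz → log (- 1#) nz ≡ 0ℚ
  log-‿1 nz = l+l≡0⇒l≡0 _ (≡.trans (≡.sym (log-* (- 1#) (- 1#) nz nz -1*-1#0))
    (≡.trans (log-cong (trans (-1*x≈-x (- 1#)) (-‿involutive 1#)) -1*-1#0 1#0) (log-1 1#0)))
    where -1*-1#0 = x#0y#0→xy#0 nz nz

  log-‿ : ∀ z z#0 -z#0 → log (- z) -z#0 ≡ log z z#0
  log-‿ z z#0 -z#0 = ≡.trans (log-cong (sym (-1*x≈-x z)) -z#0 -1z#0)
    (≡.trans (log-* (- 1#) z -1#0 z#0 -1z#0)
    (≡.trans (≡.cong (ℚ._+ log z z#0) (log-‿1 -1#0)) (ℚ.+-identityˡ _)))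
    where
    -1#0 = -#0 1#0
    -1z#0 = x#0y#0→xy#0 -1#0 z#0

  ≤q^-cong : ∀ {z w r} → z ≈ w → ∣ z ∣≤q^ r → ∣ w ∣≤q^ r
  ≤q^-cong z≈w z≤ w#0 = ≡.subst (ℚ._≤ _) (log-cong z≈w z#0 w#0) (z≤ z#0)
    where z#0 = #-congʳ (sym z≈w) w#0

  ≤q^-mono : ∀ {z r s} → r ℚ.≤ s → ∣ z ∣≤q^ r → ∣ z ∣≤q^ s
  ≤q^-mono r≤s z≤ z#0 = ℚ.≤-trans (z≤ z#0) r≤s

  ≈0⇒≤q^ : ∀ {z} r → z ≈ 0# → ∣ z ∣≤q^ r
  ≈0⇒≤q^ r z≈0 z#0 = ⊥-elim (≈0⇒¬#0 z≈0 z#0)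

  ≤q^-+ : ∀ {z w r} → ∣ z ∣≤q^ r → ∣ w ∣≤q^ r → ∣ z + w ∣≤q^ r
  ≤q^-+ {z} {w} z≤ w≤ nz with log-+ z w nz
  ... | inj₁ (z#0 , le) = ℚ.≤-trans le (z≤ z#0)
  ... | inj₂ (w#0 , le) = ℚ.≤-trans le (w≤ w#0)

  ≤q^-‿ : ∀ {z r} → ∣ z ∣≤q^ r → ∣ - z ∣≤q^ r
  ≤q^-‿ {z} z≤ nz = ≡.subst (ℚ._≤ _) (≡.sym (log-‿ z z#0 nz)) (z≤ z#0)
    where z#0 = #-congʳ (-‿involutive z) (-#0 nz)

  ≤q^-minus : ∀ {z w r} → ∣ z ∣≤q^ r → ∣ w ∣≤q^ r → ∣ z - w ∣≤q^ r
  ≤q^-minus z≤ w≤ = ≤q^-+ z≤ (≤q^-‿ w≤)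

  ≤q^-comm : ∀ {z w r} → ∣ z - w ∣≤q^ r → ∣ w - z ∣≤q^ r
  ≤q^-comm {z} {w} ≤r = ≤q^-cong (⁻¹-anti-homo‿- z w) (≤q^-‿ ≤r)

  ≤q^-trans : ∀ {z w v r} → ∣ z - w ∣≤q^ r → ∣ w - v ∣≤q^ r → ∣ z - v ∣≤q^ r
  ≤q^-trans ≤r ≤r′ = ≤q^-cong (a-b+[b-c]≈a-c _ _ _) (≤q^-+ ≤r ≤r′)

  ≤q^-* : ∀ {z w r s} → ∣ z ∣≤q^ r → ∣ w ∣≤q^ s → ∣ z * w ∣≤q^ (r ℚ.+ s)
  ≤q^-* {z} {w} z≤ w≤ nz = ≡.subst (ℚ._≤ _) (≡.sym (log-* z w z#0 w#0 nz)) (ℚ.+-mono-≤ (z≤ z#0) (w≤ w#0))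
    where
    z#0 = *#0⇒#0ˡ nz
    w#0 = *#0⇒#0ʳ nz

  ≤q^-*ˡ : ∀ {z w r} → ∣ z ∣≤q^ 0ℚ → ∣ w ∣≤q^ r → ∣ z * w ∣≤q^ r
  ≤q^-*ˡ z≤ w≤ = ≤q^-mono (ℚ.≤-reflexive (ℚ.+-identityˡ _)) (≤q^-* z≤ w≤)

  ≤q^-*ʳ : ∀ {z w r} → ∣ z ∣≤q^ r → ∣ w ∣≤q^ 0ℚ → ∣ z * w ∣≤q^ r
  ≤q^-*ʳ z≤ w≤ = ≤q^-cong (*-comm _ _) (≤q^-*ˡ w≤ z≤)

  ≤q^-1 : ∣ 1# ∣≤q^ 0ℚ
  ≤q^-1 nz = ℚ.≤-reflexive (log-1 nz)

  ≤q^-^ : ∀ {z} n → ∣ z ∣≤q^ 0ℚ → ∣ z ^ n ∣≤q^ 0ℚ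
  ≤q^-^ zero    _  = ≤q^-1
  ≤q^-^ (suc n) z≤ = ≤q^-*ˡ z≤ (≤q^-^ n z≤)

  ≤q^-divide : ∀ {z w r} z#0 → ∣ z * w ∣≤q^ (log z z#0 ℚ.+ r) → ∣ w ∣≤q^ r
  ≤q^-divide {z} {w} z#0 zw≤ w#0 = ≤-cancelˡ {log z z#0} (≡.subst (ℚ._≤ _) (log-* z w z#0 w#0 nz) (zw≤ nz))
    where
    nz = x#0y#0→xy#0 z#0 w#0
    ≤-cancelˡ : ∀ {l m n} → l ℚ.+ m ℚ.≤ l ℚ.+ n → m ℚ.≤ n
    ≤-cancelˡ {l} {m} {n} le = ≡.subst₂ ℚ._≤_ (ℚG.\\-leftDividesʳ l m) (ℚG.\\-leftDividesʳ l n)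
      (ℚ.+-monoʳ-≤ (ℚ.- l) le)

  ≤q^-∑< : ∀ {r} n g → (∀ i → i < n → ∣ g i ∣≤q^ r) → ∣ ∑< n g ∣≤q^ r
  ≤q^-∑< {r} zero g _  = ≈0⇒≤q^ r refl
  ≤q^-∑< (suc n) g g≤ = ≤q^-+ (g≤ 0 (s≤s z≤n)) (≤q^-∑< n (g ∘ suc) λ i i<n → g≤ (suc i) (s≤s i<n))

  -- Written as z = (z + w) + (-w), the ultrametric inequality names a summand that is apart from 0
  -- and at least as large as z. Since -w is too small, it must be z + w.
  +-dominant-#0 : ∀ {z w r} z#0 → ∣ w ∣≤q^ r → r ℚ.< log z z#0 → z + w # 0#
  +-dominant-#0 {z} {w} z#0 w≤ r<z with log-+ (z + w) (- w) (#-congʳ (sym (a+b-b≈a z w)) z#0)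
  ... | inj₁ (nz , _)  = nz
  ... | inj₂ (nz , le) = ⊥-elim (ℚ.<-irrefl ≡.refl (ℚ.<-≤-trans r<z (ℚ.≤-trans (ℚ.≤-reflexive
          (log-cong (sym (a+b-b≈a z w)) z#0 _)) (ℚ.≤-trans le (≤q^-‿ w≤ nz)))))

  -- The isosceles triangle principle: the lower bound comes from a = (a + b) + (-b), where -b is
  -- too small to dominate a.
  log-+-dominant : ∀ {a b r} a#0 → ∣ b ∣≤q^ r → r ℚ.< log a a#0 → ∀ nz → log (a + b) nz ≡ log a a#0
  log-+-dominant {a} {b} a#0 b≤ r<a nz = ℚ.≤-antisym
    (≤q^-+ {a} {b} (λ a#0′ → ℚ.≤-reflexive (log-cong refl a#0′ a#0)) (≤q^-mono (ℚ.<⇒≤ r<a) b≤) nz) above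
    where
    above : log a a#0 ℚ.≤ log (a + b) nz
    above with log-+ (a + b) (- b) (#-congʳ (sym (a+b-b≈a a b)) a#0)
    ... | inj₁ (nz′ , le) = ℚ.≤-trans (ℚ.≤-reflexive (log-cong (sym (a+b-b≈a a b)) a#0 _))
                              (ℚ.≤-trans le (ℚ.≤-reflexive (log-cong refl nz′ nz)))
    ... | inj₂ (nz′ , le) = ⊥-elim (ℚ.<-irrefl ≡.refl (ℚ.<-≤-trans r<a (ℚ.≤-trans (ℚ.≤-reflexive
            (log-cong (sym (a+b-b≈a a b)) a#0 _)) (ℚ.≤-trans le (≤q^-‿ b≤ nz′)))))

  ∑<-tail-≤q^ : ∀ {r} g M N → M ℕ.≤ N → (∀ i → M ℕ.≤ i → ∣ g i ∣≤q^ r) → ∣ ∑< N g - ∑< M g ∣≤q^ r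
  ∑<-tail-≤q^ g zero    N       _         g≤ =
    ≤q^-minus (≤q^-∑< N g λ i _ → g≤ i z≤n) (≈0⇒≤q^ _ refl)
  ∑<-tail-≤q^ g (suc M) (suc N) (s≤s M≤N) g≤ = ≤q^-cong (sym ([a+b]-[c+d]≈[a-c]+[b-d] _ _ _ _))
    (≤q^-+ (≈0⇒≤q^ _ (-‿inverseʳ _)) (∑<-tail-≤q^ (g ∘ suc) M N M≤N λ i M≤i → g≤ (suc i) (s≤s M≤i)))

  ∑<-isolate-≤q^ : ∀ {r} g N j → j < N → ∣ ∑< N g ∣≤q^ r → (∀ i → i ≢ j → ∣ g i ∣≤q^ r) → ∣ g j ∣≤q^ r
  ∑<-isolate-≤q^ g (suc N) zero    _         ∑≤ g≤ = ≤q^-cong (a+b-b≈a _ _)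
    (≤q^-minus ∑≤ (≤q^-∑< N (g ∘ suc) λ i _ → g≤ (suc i) λ ()))
  ∑<-isolate-≤q^ g (suc N) (suc j) (s≤s j<N) ∑≤ g≤ = ∑<-isolate-≤q^ (g ∘ suc) N j j<N
    (≤q^-cong (trans (+-congʳ (+-comm _ _)) (a+b-b≈a _ _)) (≤q^-minus ∑≤ (g≤ 0 λ ())))
    λ i i≢j → g≤ (suc i) (i≢j ∘ ℕ.suc-injective)

-- The finite field: characteristic and Fermat's identity.

module FiniteFieldProperties {c ℓ₁ ℓ₂} (𝐅 : FiniteField c ℓ₁ ℓ₂) where
  open FiniteField 𝐅 hiding (zero)
  open FieldProperties heytingField
  open SetoidReasoning setoid
  open Inverse enumeration using (to; from; strictlyInverseˡ; strictlyInverseʳ; from-cong)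

  q≢0 : NonZero q
  q≢0 = ℕ.>-nonZero (ℕ.<-trans (s≤s z≤n) 1<q)

  to≈⇒≡ : ∀ {i j} → to i ≈ to j → i ≡ j
  to≈⇒≡ eq = ≡.trans (≡.sym (strictlyInverseʳ _)) (≡.trans (from-cong eq) (strictlyInverseʳ _))

  -- `_≟_` yields only a negated equality in the nonzero case; a positive witness of apartness is
  -- found by searching the finitely many elements for an inverse.
  #0? : ∀ α → α # 0# ⊎ α ≈ 0#
  #0? α with Fin.any? (λ i → (α * to i) ≟ 1#)
  ... | yes (i , αβ≈1) = inj₁ (*≈1⇒#0 αβ≈1)
  ... | no  ¬inv       = inj₂ (¬#0⇒≈0 λ α#0 → ¬inv (from (inverse α#0) ,
          trans (*-congˡ (strictlyInverseˡ _)) (inverseʳ α#0)))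

  module _ (h h⁻¹ : Carrier → Carrier)
           (h-cong : ∀ {α β} → α ≈ β → h α ≈ h β) (h⁻¹-cong : ∀ {α β} → α ≈ β → h⁻¹ α ≈ h⁻¹ β)
           (invˡ : ∀ α → h (h⁻¹ α) ≈ α) (invʳ : ∀ α → h⁻¹ (h α) ≈ α) where
    -- Turns a bijection of the field into one of the indices, so that sums and products over the
    -- enumeration can be reindexed along it.
    permute : Permutation q q
    permute = permutation (λ i → from (h (to i))) (λ i → from (h⁻¹ (to i)))
      (λ i → to≈⇒≡ (trans (strictlyInverseˡ _) (trans (h-cong (strictlyInverseˡ _)) (invˡ _))))
      (λ i → to≈⇒≡ (trans (strictlyInverseˡ _) (trans (h⁻¹-cong (strictlyInverseˡ _)) (invʳ _))))

    to-permute : ∀ i → to (permute ⟨$⟩ʳ i) ≈ h (to i)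
    to-permute i = strictlyInverseˡ _

  -- The translation α ↦ α + 1 permutes the field, so both sides of ∑ α = ∑ (α + 1) agree.
  q⊗1≈0 : q ⊗ 1# ≈ 0#
  q⊗1≈0 = +-identityʳ-unique (sum to) _ (sym (begin
    sum to                                  ≈⟨ Sum.sum-permute to π ⟩
    sum (λ i → to (π ⟨$⟩ʳ i))               ≈⟨ Sum.sum-cong-≋ (to-permute _ _ +-congʳ +-congʳ (λ α → a-b+b≈a α 1#) (λ α → a+b-b≈a α 1#)) ⟩
    sum (λ i → to i + 1#)                   ≈⟨ Sum.∑-distrib-+ to (λ _ → 1#) ⟩
    sum to + sum (λ (_ : Fin q) → 1#)       ≈⟨ +-congˡ (Sum.sum-replicate q) ⟩
    sum to + q ⊗ 1#                         ∎))
    where π = permute (_+ 1#) (_- 1#) +-congʳ +-congʳ (λ α → a-b+b≈a α 1#) (λ α → a+b-b≈a α 1#)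

  p⊗1≈0 : p ⊗ 1# ≈ 0#
  p⊗1≈0 = ^⊗1≈0⇒⊗1≈0 p γ q⊗1≈0

  -- The exceptional factor leaves n - 1 copies of α; the α in front completes the n-th power, so
  -- that n - 1 never appears as an exponent.
  product-almost-constant : ∀ {n} (g : Fin n → Carrier) i₀ α → g i₀ ≈ 1# →
    (∀ i → i ≢ i₀ → g i ≈ α) → α * product g ≈ α ^ n
  product-almost-constant {suc n} g i₀ α gi₀≈1 g≈α = *-congˡ (begin
    product g                               ≈⟨ Product.sum-remove g ⟩
    g i₀ * product (λ i → g (punchIn i₀ i)) ≈⟨ *-cong gi₀≈1 (Product.sum-cong-≋ λ i → g≈α _ (Fin.punchInᵢ≢i i₀ i)) ⟩
    1# * product {n} (λ _ → α)              ≈⟨ *-identityˡ _ ⟩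
    product {n} (λ _ → α)                   ≈⟨ product-replicate n α ⟩
    α ^ n                                   ∎)

  -- Multiplication by a nonzero α permutes the nonzero elements, so their product P satisfies P =
  -- α^(q-1) P, and P is invertible.
  α^q≈α : ∀ α → α ^ q ≈ α
  α^q≈α α with #0? α
  ... | inj₂ α≈0 = trans (^-congˡ q α≈0) (trans (0^n≈0 q {{q≢0}}) (sym α≈0))
  ... | inj₁ α#0 = begin
    α ^ q                              ≈⟨ product-almost-constant (factor ∘ to) (from 0#) α factor-0 factor-α ⟨
    α * product (factor ∘ to)          ≈⟨ *-congˡ ∏factor≈1 ⟩
    α * 1#                             ≈⟨ *-identityʳ α ⟩
    α                                  ∎
    where
    α⁻¹ = inverse α#0
    -- The products run over all q elements, 0 included: `units` replaces 0 by 1, and `factor`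
    -- records that a factor α is gained exactly at the nonzero β.
    units factor : Carrier → Carrier
    units β with β ≟ 0#
    ... | yes _ = 1#
    ... | no  _ = β
    factor β with β ≟ 0#
    ... | yes _ = 1#
    ... | no  _ = α
    factor-0 : factor (to (from 0#)) ≈ 1#
    factor-0 with to (from 0#) ≟ 0#
    ... | yes _  = refl
    ... | no  ≉0 = ⊥-elim (≉0 (strictlyInverseˡ 0#))
    factor-α : ∀ i → i ≢ from 0# → factor (to i) ≈ α
    factor-α i i≢ with to i ≟ 0#
    ... | yes ≈0 = ⊥-elim (i≢ (to≈⇒≡ (trans ≈0 (sym (strictlyInverseˡ 0#)))))
    ... | no  _  = refl
    units-cong : ∀ {β β′} → β ≈ β′ → units β ≈ units β′
    units-cong {β} {β′} β≈β′ with β ≟ 0# | β′ ≟ 0#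
    ... | yes _  | yes _  = refl
    ... | no  _  | no  _  = β≈β′
    ... | yes ≈0 | no  ≉0 = ⊥-elim (≉0 (trans (sym β≈β′) ≈0))
    ... | no  ≉0 | yes ≈0 = ⊥-elim (≉0 (trans β≈β′ ≈0))
    units-* : ∀ β → units (α * β) ≈ factor β * units β
    units-* β with (α * β) ≟ 0# | β ≟ 0#
    ... | yes _  | yes _  = sym (*-identityˡ 1#)
    ... | no  _  | no  _  = refl
    ... | yes ≈0 | no  ≉0 = ⊥-elim (≉0 (*-cancelˡ-≈0 α#0 ≈0))
    ... | no  ≉0 | yes ≈0 = ⊥-elim (≉0 (trans (*-congˡ ≈0) (zeroʳ α)))
    units-#0 : ∀ β → units β # 0#
    units-#0 β with β ≟ 0# | #0? β
    ... | yes _  | _       = 1#0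
    ... | no  _  | inj₁ #0 = #0
    ... | no  ≉0 | inj₂ ≈0 = ⊥-elim (≉0 ≈0)
    product-#0 : ∀ {n} (g : Fin n → Carrier) → (∀ i → g i # 0#) → product g # 0#
    product-#0 {zero}  g _  = 1#0
    product-#0 {suc n} g nz = x#0y#0→xy#0 (nz zero) (product-#0 (g ∘ suc) (nz ∘ suc))
    α[α⁻¹β]≈β : ∀ β → α * (α⁻¹ * β) ≈ β
    α[α⁻¹β]≈β β = trans (sym (*-assoc _ _ _)) (trans (*-congʳ (inverseʳ α#0)) (*-identityˡ β))
    α⁻¹[αβ]≈β : ∀ β → α⁻¹ * (α * β) ≈ β
    α⁻¹[αβ]≈β β = trans (sym (*-assoc _ _ _)) (trans (*-congʳ (inverseˡ α#0)) (*-identityˡ β))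
    π = permute (α *_) (α⁻¹ *_) *-congˡ *-congˡ α[α⁻¹β]≈β α⁻¹[αβ]≈β
    P = product (units ∘ to)
    P≈∏factor*P : P ≈ product (factor ∘ to) * P
    P≈∏factor*P = begin
      P                                       ≈⟨ Product.sum-permute (units ∘ to) π ⟩
      product (λ i → units (to (π ⟨$⟩ʳ i)))   ≈⟨ Product.sum-cong-≋ (λ i → trans
        (units-cong (to-permute (α *_) (α⁻¹ *_) *-congˡ *-congˡ α[α⁻¹β]≈β α⁻¹[αβ]≈β i)) (units-* (to i))) ⟩
      product (λ i → factor (to i) * units (to i)) ≈⟨ Product.∑-distrib-+ (factor ∘ to) (units ∘ to) ⟩
      product (factor ∘ to) * P               ∎
    P#0 : P # 0#
    P#0 = product-#0 (units ∘ to) (units-#0 ∘ to)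
    ∏factor≈1 : product (factor ∘ to) ≈ 1#
    ∏factor≈1 = begin
      product (factor ∘ to)                      ≈⟨ *-identityʳ _ ⟨
      product (factor ∘ to) * 1#                 ≈⟨ *-congˡ (inverseʳ P#0) ⟨
      product (factor ∘ to) * (P * inverse P#0)  ≈⟨ *-assoc _ _ _ ⟨
      product (factor ∘ to) * P * inverse P#0    ≈⟨ *-congʳ P≈∏factor*P ⟨
      P * inverse P#0                            ≈⟨ inverseʳ P#0 ⟩
      1#                                         ∎

-- Constants, powers of x and the zero test in the Laurent series field.

module LaurentSeriesProperties {c ℓ₁ ℓ₂} (𝐅 : FiniteField c ℓ₁ ℓ₂) where
  private module F = FiniteField 𝐅
  open LaurentSeries 𝐅
  open FieldProperties F.heytingField using (∑<-cong; ∑<-0)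

  const-cong : ∀ {α β} → α F.≈ β → const α ≈ᴷ const β
  const-cong α≈β (+ 0)     = α≈β
  const-cong α≈β (+ suc _) = F.refl
  const-cong α≈β -[1+ _ ]  = F.refl

  const-+ : ∀ α β → const (α F.+ β) ≈ᴷ const α +ᴷ const β
  const-+ α β (+ 0)     = F.refl
  const-+ α β (+ suc _) = F.sym (F.+-identityˡ _)
  const-+ α β -[1+ _ ]  = F.sym (F.+-identityˡ _)

  const-* : ∀ α β → const (α F.* β) ≈ᴷ const α *ᴷ const β
  const-* α β (+ 0)     = F.sym (F.+-identityʳ _)
  -- The rewrite removes the `+ 0` left by subtracting the start index. In the convolution the
  -- summand j = 0 vanishes through `const β`, all others through `const α`.
  const-* α β (+ suc k) rewrite ℕ.+-identityʳ k = F.sym (F.trans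
    (F.+-cong (F.zeroʳ α) (F.trans (∑<-cong (suc k) {g = λ _ → F.0#} λ i _ → F.zeroˡ (coeff (const β) (+ (k ℕ.∸ i)))) (∑<-0 (suc k))))
    (F.+-identityˡ _))
  const-* α β -[1+ _ ]  = F.refl

  ∣const∣≡1 : ∀ {α} → ¬ α F.≈ F.0# → ∣ const α ∣≡q^- (+ 0)
  ∣const∣≡1 {α} α≉0 = vanishes (const α) , α≉0

  X^ : ℕ → K
  X^ zero    = const F.1#
  X^ (suc j) = X *ᴷ X^ j

  -- The test points xʲ. Their integrality is read off from `start`, which is additive under
  -- products.
  X^ᴼ : ℕ → O
  X^ᴼ j = X^ j , noPrincipalPart⇒O (X^ j) λ i i<0 → vanishes (X^ j) i (ℤ.<-≤-trans i<0 (0≤start j))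
    where
    0≤start : ∀ j → + 0 ℤ.≤ start (X^ j)
    0≤start zero    = ℤ.≤-refl
    0≤start (suc j) = ℤ.+-mono-≤ {+ 0} {+ 1} (ℤ.+≤+ z≤n) (0≤start j)

  -- Strong induction on the index: a nonzero coefficient preceded only by zeros would be an order.
  -- It replaces a decision whether z is 0, which would need a search through infinitely many
  -- coefficients.
  noOrder⇒≈0 : ∀ z → ∣ z ∣≤q^ (+ 0) → ¬ (∃[ n ] ∣ z ∣≡q^- n) → z ≈ᴷ const F.0#
  noOrder⇒≈0 z z∈O none i = F.trans (zero-coeff i) (F.sym (const-0 i))
    where
    const-0 : ∀ i → coeff (const F.0#) i F.≈ F.0#
    const-0 (+ 0)     = F.refl
    const-0 (+ suc _) = F.refl
    const-0 -[1+ _ ]  = F.refl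
    below : ∀ k → (∀ {j} → j < k → coeff z (+ j) F.≈ F.0#) → ∀ i → i ℤ.< + k → coeff z i F.≈ F.0#
    below k ih (+ j)    (ℤ.+<+ j<k) = ih j<k
    below k ih -[1+ j ] _           = O⇒noPrincipalPart z z∈O -[1+ j ] ℤ.-<+
    zero-coeff⁺ : ∀ k → coeff z (+ k) F.≈ F.0#
    zero-coeff⁺ = <-rec _ step
      where
      step : ∀ k → (∀ {j} → j < k → coeff z (+ j) F.≈ F.0#) → coeff z (+ k) F.≈ F.0#
      step k ih with coeff z (+ k) F.≟ F.0#
      ... | yes ≈0 = ≈0
      ... | no  ≉0 = ⊥-elim (none (+ k , below k ih , ≉0))
    zero-coeff : ∀ i → coeff z i F.≈ F.0#
    zero-coeff (+ k)      = zero-coeff⁺ k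
    zero-coeff i@(-[1+ _ ]) = O⇒noPrincipalPart z z∈O i ℤ.-<+

-- Embedding into the completed closure, and the Carlitz polynomials.

module CarlitzProperties {f f₁ f₂ c ℓ₁ ℓ₂ c′ ℓ₁′ ℓ₂′} (𝐅 : FiniteField f f₁ f₂)
       (𝐊 : CompletedAlgebraicClosure 𝐅 c ℓ₁ ℓ₂ c′ ℓ₁′ ℓ₂′) where
  private
    module F where
      open FiniteField 𝐅 public
      open FieldProperties heytingField public using (_⊗_; +-inverseˡ-unique; -‿involutive)
      open FiniteFieldProperties 𝐅 public
  open F using (q; elements)
  open CompletedAlgebraicClosure 𝐊
  open LaurentSeries 𝐅 hiding (∣_∣≤q^_)
  open LaurentSeriesProperties 𝐅
  open Carlitz 𝐅 𝐊
  open ValuedField K̄c hiding (Carrier; q^_·∣_∣⟶0; zero)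
  open FieldProperties heytingField
  open ValuedProperties K̄c
  open SetoidReasoning setoid
  private
    module AC where
      open IsAlgebraicClosure isAlgebraicClosure public
      open RingMorphisms.IsRingMonomorphism isRingMonomorphism public
    module Comp where
      open IsCompletion isCompletion public
      open RingMorphisms.IsRingMonomorphism isRingMonomorphism public

  ι-cong : ∀ {z w} → z ≈ᴷ w → ι z ≈ ι w
  ι-cong z≈w = Comp.⟦⟧-cong (AC.⟦⟧-cong z≈w)

  ι-+ : ∀ z w → ι (z +ᴷ w) ≈ ι z + ι w
  ι-+ z w = trans (Comp.⟦⟧-cong (AC.+-homo z w)) (Comp.+-homo _ _)

  ι-* : ∀ z w → ι (z *ᴷ w) ≈ ι z * ι w
  ι-* z w = trans (Comp.⟦⟧-cong (AC.*-homo z w)) (Comp.*-homo _ _)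

  ι-isometric : ∀ z n → ∣ z ∣≡q^- n → Σ[ nz ∈ ι z # 0# ] log (ι z) nz ≡ (ℤ.- n) ℚ./ 1
  ι-isometric z n ord with AC.isometric z n ord
  ... | nz , eq with Comp.isometric _ nz
  ...   | nz′ , eq′ = nz′ , ≡.trans eq′ eq

  φ : F.Carrier → Carrier
  φ α = ι (const α)

  φ-cong : ∀ {α β} → α F.≈ β → φ α ≈ φ β
  φ-cong α≈β = ι-cong (const-cong α≈β)

  φ-+ : ∀ α β → φ (α F.+ β) ≈ φ α + φ β
  φ-+ α β = trans (ι-cong (const-+ α β)) (ι-+ _ _)

  φ-* : ∀ α β → φ (α F.* β) ≈ φ α * φ β
  φ-* α β = trans (ι-cong (const-* α β)) (ι-* _ _)

  φ-0 : φ F.0# ≈ 0#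
  φ-0 = trans (Comp.⟦⟧-cong AC.0#-homo) Comp.0#-homo

  φ-1 : φ F.1# ≈ 1#
  φ-1 = trans (Comp.⟦⟧-cong AC.1#-homo) Comp.1#-homo

  φ-minus : ∀ α β → φ (α F.- β) ≈ φ α - φ β
  φ-minus α β = trans (φ-+ α (F.- β)) (+-congˡ (+-inverseˡ-unique _ _
    (trans (sym (φ-+ (F.- β) β)) (trans (φ-cong (F.-‿inverseˡ β)) φ-0))))

  φ-^ : ∀ α n → φ (α F.^ n) ≈ φ α ^ n
  φ-^ α zero    = φ-1
  φ-^ α (suc n) = trans (φ-* α _) (*-congˡ (φ-^ α n))

  φ-⊗1 : ∀ n → φ (n F.⊗ F.1#) ≈ n ⊗ 1#
  φ-⊗1 zero    = φ-0
  φ-⊗1 (suc n) = trans (φ-+ _ _) (+-cong φ-1 (φ-⊗1 n))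

  φ-unit : ∀ {α} → ¬ α F.≈ F.0# → Σ[ nz ∈ φ α # 0# ] log (φ α) nz ≡ 0ℚ
  φ-unit α≉0 = ι-isometric _ (+ 0) (∣const∣≡1 α≉0)

  ∣φ∣≤1 : ∀ α → ∣ φ α ∣≤q^ 0ℚ
  ∣φ∣≤1 α with α F.≟ F.0#
  ... | yes α≈0 = ≈0⇒≤q^ 0ℚ (trans (φ-cong α≈0) φ-0)
  ... | no  α≉0 = λ nz → ℚ.≤-reflexive (≡.trans (log-cong refl nz _) (proj₂ (φ-unit α≉0)))

  -1ℚ : ℚ
  -1ℚ = (ℤ.- + 1) ℚ./ 1

  -1<0 : -1ℚ ℚ.< 0ℚ
  -1<0 = ℚ.*<* ℤ.-<+

  -1≤0 : -1ℚ ℚ.≤ 0ℚ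
  -1≤0 = ℚ.<⇒≤ -1<0

  x#0 : x # 0#
  x#0 = proj₁ (ι-isometric X (+ 1) ∣X∣≡q^-1)

  log-x : ∀ nz → log x nz ≡ -1ℚ
  log-x nz = ≡.trans (log-cong refl nz x#0) (proj₂ (ι-isometric X (+ 1) ∣X∣≡q^-1))

  ∣x∣≤q^-1 : ∣ x ∣≤q^ -1ℚ
  ∣x∣≤q^-1 nz = ℚ.≤-reflexive (log-x nz)

  ∣x∣≤1 : ∣ x ∣≤q^ 0ℚ
  ∣x∣≤1 = ≤q^-mono -1≤0 ∣x∣≤q^-1

  ι-X^ : ∀ j → ι (X^ j) ≈ x ^ j
  ι-X^ zero    = φ-1
  ι-X^ (suc j) = trans (ι-* X (X^ j)) (*-congˡ (ι-X^ j))

  -- The order of t cannot be computed, but the comparison of rationals is decidable. If the bound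
  -- failed, t could have no order, hence would be 0, against `nz`.
  ∣O∣≤1 : ∀ t → ∣ ι ⌊ t ⌋ ∣≤q^ 0ℚ
  ∣O∣≤1 t nz with log (ι ⌊ t ⌋) nz ℚ.≤? 0ℚ
  ... | yes ≤0 = ≤0
  ... | no  ≰0 = ⊥-elim (≈0⇒¬#0 (trans (ι-cong (noOrder⇒≈0 ⌊ t ⌋ (∣⌊⌋∣≤1 t) none)) φ-0) nz)
    where
    /1≤0 : ∀ i → i ℤ.≤ + 0 → i ℚ./ 1 ℚ.≤ 0ℚ
    /1≤0 i i≤0 = fromℚᵘ-mono-≤ {ℚᵘ.mkℚᵘ i 0} {ℚᵘ.mkℚᵘ (+ 0) 0}
      (ℚᵘ.*≤* (≡.subst₂ ℤ._≤_ (≡.sym (ℤ.*-identityʳ i)) ≡.refl i≤0))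
    none : ¬ (∃[ n ] ∣ ⌊ t ⌋ ∣≡q^- n)
    none (n , ord) = ≰0 (ℚ.≤-trans (ℚ.≤-reflexive
      (≡.trans (log-cong refl nz _) (proj₂ (ι-isometric ⌊ t ⌋ n ord)))) (/1≤0 _ (∣⌊⌋∣≤1 t n ord)))

  instance
    q≢0 : NonZero q
    q≢0 = F.q≢0

  q^≢0 : ∀ i → NonZero (q ℕ.^ i)
  q^≢0 i = ℕ.m^n≢0 q i

  additive-q : Additive q
  additive-q = additive-^ F.p F.γ (frobenius F.p-prime
    (trans (sym (φ-⊗1 F.p)) (trans (φ-cong F.p⊗1≈0) φ-0)))

  additive-q^ : ∀ i → Additive (q ℕ.^ i)
  additive-q^ i = additive-^ q i additive-q

  φ^q≈φ : ∀ α → φ α ^ q ≈ φ α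
  φ^q≈φ α = trans (sym (φ-^ α q)) (φ-cong (F.α^q≈α α))

  [^q^i]^q : ∀ z i → (z ^ (q ℕ.^ i)) ^ q ≈ z ^ (q ℕ.^ suc i)
  [^q^i]^q z i = trans (^-assocʳ z (q ℕ.^ i) q) (^-congʳ z (ℕ.*-comm (q ℕ.^ i) q))

  φ^q^i≈φ : ∀ α i → φ α ^ (q ℕ.^ i) ≈ φ α
  φ^q^i≈φ α zero    = *-identityʳ _
  φ^q^i≈φ α (suc i) = trans (sym ([^q^i]^q (φ α) i)) (trans (^-congˡ q (φ^q^i≈φ α i)) (φ^q≈φ α))

  ∏-elements : ∀ g → ∏ elements g ≈ product (g ∘ Inverse.to F.enumeration)
  ∏-elements g = trans (reflexive (∏-map (Inverse.to F.enumeration) (allFin q) g)) (∏-tabulate id (g ∘ Inverse.to F.enumeration))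

  monic-z^n-z : ∀ n → 1 < n → Σ[ as ∈ Vec Carrier n ] (∀ z → evalMonic as z ≈ z ^ n - z)
  monic-z^n-z (suc zero)    (s≤s ())
  -- Constant term 0, linear coefficient -1, then zeros below the implicit leading 1; n > 1 keeps
  -- the linear term apart from the leading one.
  monic-z^n-z (suc (suc n)) _ = 0# ∷ - 1# ∷ Vec.replicate n 0# , λ z → begin
    0# + z * (- 1# + z * evalMonic (Vec.replicate n 0#) z) ≈⟨ +-identityˡ _ ⟩
    z * (- 1# + z * evalMonic (Vec.replicate n 0#) z)      ≈⟨ *-congˡ (+-congˡ (*-congˡ (pow n z))) ⟩
    z * (- 1# + z * z ^ n)                                 ≈⟨ *-congˡ (+-comm _ _) ⟩
    z * (z * z ^ n - 1#)                                   ≈⟨ x[y-z]≈xy-xz _ _ _ ⟩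
    z * (z * z ^ n) - z * 1#                               ≈⟨ +-congˡ (-‿cong (*-identityʳ z)) ⟩
    z * (z * z ^ n) - z                                    ∎
    where
    pow : ∀ n z → evalMonic (Vec.replicate n 0#) z ≈ z ^ n
    pow zero    z = refl
    pow (suc n) z = trans (+-identityˡ _) (*-congˡ (pow n z))

  -- By Fermat's identity the q embedded constants are roots of the monic polynomial z^q - z; they
  -- are mutually apart because nonzero constants have absolute value 1.
  ∏[z-φα] : ∀ z → ∏ elements (λ α → z - φ α) ≈ z ^ q - z
  ∏[z-φα] z with monic-z^n-z q F.1<q
  ... | as , evalMonic≈ = trans (∏-elements _) (trans (sym (evalMonic-roots as (φ ∘ to) apart root z)) (evalMonic≈ z))
    where
    open Inverse F.enumeration using (to)
    apart : ∀ i j → i ≢ j → φ (to i) - φ (to j) # 0#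
    apart i j i≢j = #-congʳ (φ-minus _ _)
      (proj₁ (φ-unit λ ≈0 → i≢j (F.to≈⇒≡ (F.trans (F.+-inverseˡ-unique _ _ ≈0) (F.-‿involutive _)))))
    root : ∀ i → evalMonic as (φ (to i)) ≈ 0#
    root i = trans (evalMonic≈ _) (x≈y⇒x∙y⁻¹≈ε (φ^q≈φ _))

  -- Substitute z/w in the preceding identity and multiply by w^q.
  ∏[z-φα*w] : ∀ z w → w # 0# → ∏ elements (λ α → z - φ α * w) ≈ z ^ q - w ^ (q ℕ.∸ 1) * z
  ∏[z-φα*w] z w w#0 = begin
    ∏ elements (λ α → z - φ α * w)                   ≈⟨ ∏-cong elements pull ⟩
    ∏ elements (λ α → w * (s - φ α))                 ≈⟨ ∏-* elements _ _ ⟩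
    ∏ elements (λ _ → w) * ∏ elements (λ α → s - φ α) ≈⟨ *-cong (trans (∏-elements _) (product-replicate q w)) (∏[z-φα] s) ⟩
    w ^ q * (s ^ q - s)                              ≈⟨ x[y-z]≈xy-xz _ _ _ ⟩
    w ^ q * s ^ q - w ^ q * s                        ≈⟨ +-cong (trans (sym (^-distrib-* w s q)) (^-congˡ q ws≈z)) (-‿cong w^q*s) ⟩
    z ^ q - w ^ (q ℕ.∸ 1) * z                        ∎
    where
    s = inverse w#0 * z
    ws≈z : w * s ≈ z
    ws≈z = trans (sym (*-assoc _ _ _)) (trans (*-congʳ (inverseʳ w#0)) (*-identityˡ z))
    pull : ∀ α → z - φ α * w ≈ w * (s - φ α)
    pull α = sym (trans (x[y-z]≈xy-xz _ _ _) (+-cong ws≈z (-‿cong (*-comm _ _))))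
    w^q*s : w ^ q * s ≈ w ^ (q ℕ.∸ 1) * z
    w^q*s = begin
      w ^ q * s                    ≈⟨ *-congʳ (^-congʳ w (ℕ.m+[n∸m]≡n {1} (ℕ.<⇒≤ F.1<q))) ⟨
      (w * w ^ (q ℕ.∸ 1)) * s      ≈⟨ *-congʳ (*-comm _ _) ⟩
      (w ^ (q ℕ.∸ 1) * w) * s      ≈⟨ *-assoc _ _ _ ⟩
      w ^ (q ℕ.∸ 1) * (w * s)      ≈⟨ *-congˡ ws≈z ⟩
      w ^ (q ℕ.∸ 1) * z            ∎

  -- Carlitz polynomials

  evalₓ : ∀ {n} → Vec F.Carrier n → Carrier
  evalₓ m = eval (Vec.map φ m) x

  -- `polynomials` grows at the constant term, whereas the recursion for `e` groups polynomials by
  -- the coefficient of xⁿ, the last entry. The induction interchanges the two products over the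
  -- first and the last coefficient.
  ∏-polynomials-∷ʳ : ∀ n g →
    ∏ (polynomials (suc n)) g ≈ ∏ elements (λ α → ∏ (polynomials n) λ m → g (m ∷ʳ α))
  ∏-polynomials-∷ʳ zero    g = ∏-cartesianProductWith _∷_ elements (polynomials zero) g
  ∏-polynomials-∷ʳ (suc n) g = begin
    ∏ (polynomials (suc (suc n))) g
      ≈⟨ ∏-cartesianProductWith _∷_ elements (polynomials (suc n)) g ⟩
    ∏ elements (λ β → ∏ (polynomials (suc n)) λ m → g (β ∷ m))
      ≈⟨ ∏-cong elements (λ β → ∏-polynomials-∷ʳ n (g ∘ (β ∷_))) ⟩
    ∏ elements (λ β → ∏ elements λ α → ∏ (polynomials n) λ m → g (β ∷ (m ∷ʳ α)))
      ≈⟨ ∏-comm elements elements (λ β α → ∏ (polynomials n) λ m → g (β ∷ (m ∷ʳ α))) ⟩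
    ∏ elements (λ α → ∏ elements λ β → ∏ (polynomials n) λ m → g ((β ∷ m) ∷ʳ α))
      ≈⟨ ∏-cong elements (λ α → ∏-cartesianProductWith _∷_ elements (polynomials n) (g ∘ (_∷ʳ α))) ⟨
    ∏ elements (λ α → ∏ (polynomials (suc n)) λ m → g (m ∷ʳ α)) ∎

  evalₓ-∷ʳ : ∀ {n} (m : Vec F.Carrier n) α → evalₓ (m ∷ʳ α) ≈ φ α * x ^ n + evalₓ m
  evalₓ-∷ʳ []      α = +-cong (sym (*-identityʳ _)) (zeroʳ x)
  evalₓ-∷ʳ {suc n} (β ∷ m) α = begin
    φ β + x * evalₓ (m ∷ʳ α)                  ≈⟨ +-congˡ (*-congˡ (evalₓ-∷ʳ m α)) ⟩
    φ β + x * (φ α * x ^ n + evalₓ m)         ≈⟨ +-congˡ (distribˡ _ _ _) ⟩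
    φ β + (x * (φ α * x ^ n) + x * evalₓ m)   ≈⟨ +P.x∙yz≈y∙xz _ _ _ ⟩
    x * (φ α * x ^ n) + (φ β + x * evalₓ m)   ≈⟨ +-congʳ (*P.x∙yz≈y∙xz _ _ _) ⟩
    φ α * (x * x ^ n) + (φ β + x * evalₓ m)   ∎

  ∣evalₓ∣≤1 : ∀ {n} (m : Vec F.Carrier n) → ∣ evalₓ m ∣≤q^ 0ℚ
  ∣evalₓ∣≤1 []      = ≈0⇒≤q^ 0ℚ refl
  ∣evalₓ∣≤1 (α ∷ m) = ≤q^-+ (∣φ∣≤1 α) (≤q^-*ˡ ∣x∣≤1 (∣evalₓ∣≤1 m))

  -- Induction from the constant term: if it is nonzero it has absolute value 1 and dominates the
  -- rest, which is divisible by x; if it is zero, a factor x splits off and the degree drops.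
  x^n-evalₓ#0 : ∀ {n} (m : Vec F.Carrier n) → x ^ n - evalₓ m # 0#
  x^n-evalₓ#0 []      = #-congʳ (sym (x-0≈x 1#)) 1#0
  x^n-evalₓ#0 {suc n} (α ∷ m) = #-congʳ (sym split) split#0
    where
    y = x ^ n - evalₓ m
    split : x ^ suc n - (φ α + x * evalₓ m) ≈ - φ α + x * y
    split = begin
      x ^ suc n - (φ α + x * evalₓ m)       ≈⟨ +-congˡ (-‿+-comm _ _) ⟨
      x ^ suc n + (- φ α - x * evalₓ m)     ≈⟨ +P.x∙yz≈y∙xz _ _ _ ⟩
      - φ α + (x * x ^ n - x * evalₓ m)     ≈⟨ +-congˡ (x[y-z]≈xy-xz _ _ _) ⟨
      - φ α + x * y                         ∎
    ∣xy∣ : ∣ x * y ∣≤q^ -1ℚ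
    ∣xy∣ = ≤q^-*ʳ ∣x∣≤q^-1 (≤q^-minus (≤q^-^ n ∣x∣≤1) (∣evalₓ∣≤1 m))
    split#0 : - φ α + x * y # 0#
    split#0 with α F.≟ F.0#
    ... | yes α≈0 = #-congʳ (sym (trans (+-congʳ (trans (-‿cong (trans (φ-cong α≈0) φ-0)) -0#≈0#)) (+-identityˡ _)))
                      (x#0y#0→xy#0 x#0 (x^n-evalₓ#0 m))
    ... | no  α≉0 with φ-unit α≉0
    ...   | nz , log≡0 = +-dominant-#0 (-#0 nz) ∣xy∣
              (≡.subst (-1ℚ ℚ.<_) (≡.sym (≡.trans (log-‿ _ nz _) log≡0)) -1<0)

  e≈∏ : ∀ n t → e n t ≈ ∏ (polynomials n) λ m → t - evalₓ m
  e≈∏ zero    t = sym (trans (*-identityʳ _) (x-0≈x t))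
  e≈∏ (suc n) t = refl

  e-suc≈∏ : ∀ n t → e (suc n) t ≈ ∏ elements λ α → e n (t - φ α * x ^ n)
  e-suc≈∏ n t = trans (∏-polynomials-∷ʳ n _) (∏-cong elements λ α → trans
    (∏-cong (polynomials n) λ m → trans (+-congˡ (trans (-‿cong (evalₓ-∷ʳ m α)) (sym (-‿+-comm _ _)))) (sym (+-assoc _ _ _)))
    (sym (e≈∏ n _)))

  e-x^n#0 : ∀ n → e n (x ^ n) # 0#
  e-x^n#0 n = #-congʳ (sym (e≈∏ n _)) (∏-#0 (polynomials n) x^n-evalₓ#0)

  Δ : ℕ → Carrier
  Δ n = e n (x ^ n) ^ (q ℕ.∸ 1)

  -- The coefficients of the 𝐅-linear polynomial eₙ(t) = ∑ᵢ ε n i · t^(qⁱ).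
  ε : ℕ → ℕ → Carrier
  ε zero    zero    = 1#
  ε zero    (suc i) = 0#
  ε (suc n) zero    = - (Δ n * ε n zero)
  ε (suc n) (suc i) = ε n i ^ q - Δ n * ε n (suc i)

  -- Any range exceeding n is allowed, so that expansions of different degrees can be combined over
  -- a common range.
  HasExpansion : ℕ → Set _
  HasExpansion n = ∀ N t → n < N → e n t ≈ ∑< N λ i → ε n i * t ^ (q ℕ.^ i)

  -- Each power t^(qⁱ) is 𝐅-linear: it is additive in characteristic p, and constants are fixed by
  -- q-th powers.
  e-linear : ∀ n → HasExpansion n → ∀ t α y → e n (t - φ α * y) ≈ e n t - φ α * e n y
  e-linear n exp t α y = begin
    e n (t - φ α * y)                                         ≈⟨ exp N _ n<N ⟩
    ∑< N (λ i → ε n i * (t - φ α * y) ^ (q ℕ.^ i))            ≈⟨ ∑<-cong N (λ i _ → term i) ⟩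
    ∑< N (λ i → b t i - φ α * b y i)
                                                                                        ≈⟨ ∑<-minus N (b t) (λ i → φ α * b y i) ⟩
    ∑< N (b t) - ∑< N (λ i → φ α * b y i)
                                                              ≈⟨ +-cong (exp N t n<N) (-‿cong (trans (*-congˡ (exp N y n<N)) (∑<-*ˡ N (φ α) (b y)))) ⟨
    e n t - φ α * e n y                                       ∎
    where
    N = suc n
    b : Carrier → ℕ → Carrier
    b t i = ε n i * t ^ (q ℕ.^ i)
    n<N = ℕ.n<1+n n
    term : ∀ i → ε n i * (t - φ α * y) ^ (q ℕ.^ i) ≈ ε n i * t ^ (q ℕ.^ i) - φ α * (ε n i * y ^ (q ℕ.^ i))
    term i = begin
      ε n i * (t - φ α * y) ^ (q ℕ.^ i)
        ≈⟨ *-congˡ (additive-minus (q ℕ.^ i) {{q^≢0 i}} (additive-q^ i) _ _) ⟩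
      ε n i * (t ^ (q ℕ.^ i) - (φ α * y) ^ (q ℕ.^ i))
        ≈⟨ *-congˡ (+-congˡ (-‿cong (trans (^-distrib-* _ _ (q ℕ.^ i)) (*-congʳ (φ^q^i≈φ α i))))) ⟩
      ε n i * (t ^ (q ℕ.^ i) - φ α * y ^ (q ℕ.^ i))
        ≈⟨ x[y-z]≈xy-xz _ _ _ ⟩
      ε n i * t ^ (q ℕ.^ i) - ε n i * (φ α * y ^ (q ℕ.^ i))
        ≈⟨ +-congˡ (-‿cong (*P.x∙yz≈y∙xz _ _ _)) ⟩
      ε n i * t ^ (q ℕ.^ i) - φ α * (ε n i * y ^ (q ℕ.^ i)) ∎

  -- The expansion of eₙ enters as a hypothesis because `e-expansion` at `suc n` calls this
  -- recursion at n; `e-suc` discharges it afterwards.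
  e-suc′ : ∀ n → HasExpansion n → ∀ t → e (suc n) t ≈ e n t ^ q - Δ n * e n t
  e-suc′ n exp t = trans (e-suc≈∏ n t) (trans (∏-cong elements λ α → e-linear n exp t α (x ^ n))
    (∏[z-φα*w] (e n t) (e n (x ^ n)) (e-x^n#0 n)))

  e-expansion : ∀ n → HasExpansion n
  e-expansion zero    (suc N) t _ = sym (trans
    (+-cong (trans (*-identityˡ _) (*-identityʳ t)) (trans (∑<-cong N {g = λ _ → 0#} λ i _ → zeroˡ (t ^ (q ℕ.^ suc i))) (∑<-0 N)))
    (+-identityʳ t))
  e-expansion (suc n) (suc N) t (s≤s n<N) = begin
    e (suc n) t                      ≈⟨ e-suc′ n (e-expansion n) t ⟩
    e n t ^ q - Δ n * e n t          ≈⟨ +-cong pow (-‿cong (trans (*-congˡ (e-expansion n (suc N) t (ℕ.m≤n⇒m≤1+n n<N))) (∑<-*ˡ (suc N) (Δ n) b))) ⟩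
    ∑< (suc N) a - ∑< (suc N) (λ i → Δ n * b i) ≈⟨ ∑<-minus (suc N) a (λ i → Δ n * b i) ⟨
    ∑< (suc N) (λ i → a i - Δ n * b i) ≈⟨ ∑<-cong (suc N) (λ i _ → term i) ⟩
    ∑< (suc N) (λ i → ε (suc n) i * t ^ (q ℕ.^ i)) ∎
    where
    b = λ i → ε n i * t ^ (q ℕ.^ i)
    -- A q-th power turns t^(qⁱ) into t^(qⁱ⁺¹), so the coefficients shift by one place and a 0 fills
    -- the first.
    a : ℕ → Carrier
    a zero    = 0#
    a (suc i) = ε n i ^ q * t ^ (q ℕ.^ suc i)
    pow : e n t ^ q ≈ ∑< (suc N) a
    pow = begin
      e n t ^ q                      ≈⟨ ^-congˡ q (e-expansion n N t n<N) ⟩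
      ∑< N b ^ q                     ≈⟨ additive-∑< q additive-q N b ⟩
      ∑< N (λ i → b i ^ q)           ≈⟨ ∑<-cong N (λ i _ → trans (^-distrib-* (ε n i) (t ^ (q ℕ.^ i)) q) (*-congˡ ([^q^i]^q t i))) ⟩
      ∑< N (a ∘ suc)                 ≈⟨ +-identityˡ _ ⟨
      ∑< (suc N) a                   ∎
    term : ∀ i → a i - Δ n * b i ≈ ε (suc n) i * t ^ (q ℕ.^ i)
    term zero    = trans (+-identityˡ _) (trans (-‿cong (sym (*-assoc _ _ _))) (-‿distribˡ-* _ _))
    term (suc i) = trans (+-congˡ (-‿cong (sym (*-assoc _ _ _)))) (sym ([y-z]x≈yx-zx _ _ _))

  e-suc : ∀ n t → e (suc n) t ≈ e n t ^ q - Δ n * e n t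
  e-suc n = e-suc′ n (e-expansion n)

-- Integral change of basis between the t^(qⁱ) and the eᵢ.

module CarlitzExpansions {f f₁ f₂ c ℓ₁ ℓ₂ c′ ℓ₁′ ℓ₂′} (𝐅 : FiniteField f f₁ f₂)
       (𝐊 : CompletedAlgebraicClosure 𝐅 c ℓ₁ ℓ₂ c′ ℓ₁′ ℓ₂′) where
  private module F = FiniteField 𝐅
  open F using (q)
  open CompletedAlgebraicClosure 𝐊
  open LaurentSeries 𝐅 using (⌊_⌋)
  open Carlitz 𝐅 𝐊
  open C₀ using (⟦_⟧)
  open ValuedField K̄c hiding (Carrier; q^_·∣_∣⟶0; zero)
  open FieldProperties heytingField
  open ValuedProperties K̄c
  open CarlitzProperties 𝐅 𝐊
  open SetoidReasoning setoid

  ≤q^-∏ : ∀ {a} {A : Set a} (ts : List A) g → (∀ t → ∣ g t ∣≤q^ 0ℚ) → ∣ ∏ ts g ∣≤q^ 0ℚ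
  ≤q^-∏ []       g _  = ≤q^-1
  ≤q^-∏ (t ∷ ts) g g≤ = ≤q^-*ˡ (g≤ t) (≤q^-∏ ts g g≤)

  ∣e∣≤1 : ∀ n {t} → ∣ t ∣≤q^ 0ℚ → ∣ e n t ∣≤q^ 0ℚ
  ∣e∣≤1 n t≤1 = ≤q^-cong (sym (e≈∏ n _)) (≤q^-∏ (polynomials n) _ λ m → ≤q^-minus t≤1 (∣evalₓ∣≤1 m))

  e-cong : ∀ n {t s} → t ≈ s → e n t ≈ e n s
  e-cong n t≈s = trans (e≈∏ n _) (trans (∏-cong (polynomials n) λ m → +-congʳ t≈s) (sym (e≈∏ n _)))

  ∣Δ∣≤1 : ∀ n → ∣ Δ n ∣≤q^ 0ℚ
  ∣Δ∣≤1 n = ≤q^-^ (q ℕ.∸ 1) (∣e∣≤1 n (≤q^-^ n ∣x∣≤1))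

  ∣ε∣≤1 : ∀ n i → ∣ ε n i ∣≤q^ 0ℚ
  ∣ε∣≤1 zero    zero    = ≤q^-1
  ∣ε∣≤1 zero    (suc i) = ≈0⇒≤q^ 0ℚ refl
  ∣ε∣≤1 (suc n) zero    = ≤q^-‿ (≤q^-*ˡ (∣Δ∣≤1 n) (∣ε∣≤1 n zero))
  ∣ε∣≤1 (suc n) (suc i) = ≤q^-minus (≤q^-^ q (∣ε∣≤1 n i)) (≤q^-*ˡ (∣Δ∣≤1 n) (∣ε∣≤1 n (suc i)))

  ε-vanishes : ∀ n i → n < i → ε n i ≈ 0#
  ε-vanishes zero    (suc i) _         = refl
  ε-vanishes (suc n) (suc i) (s≤s n<i) = trans
    (+-cong (trans (^-congˡ q (ε-vanishes n i n<i)) (0^n≈0 q))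
            (-‿cong (trans (*-congˡ (ε-vanishes n (suc i) (ℕ.m≤n⇒m≤1+n n<i))) (zeroʳ (Δ n)))))
    (-‿inverseʳ 0#)

  -- By the recursion, a zero of eₙ is a zero of eₙ₊₁. The new zero is t = xⁿ, where the two terms
  -- cancel because `Δ n` is the (q - 1)-th power of eₙ(xⁿ).
  e-x^j≈0 : ∀ n j → j < n → e n (x ^ j) ≈ 0#
  e-x^j≈0 (suc n) j (s≤s j≤n) = trans (e-suc n (x ^ j)) (case (ℕ.m≤n⇒m<n∨m≡n j≤n))
    where
    case : j < n ⊎ j ≡ n → e n (x ^ j) ^ q - Δ n * e n (x ^ j) ≈ 0#
    case (inj₁ j<n) = trans (+-cong (trans (^-congˡ q (e-x^j≈0 n j j<n)) (0^n≈0 q))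
      (-‿cong (trans (*-congˡ (e-x^j≈0 n j j<n)) (zeroʳ (Δ n))))) (-‿inverseʳ 0#)
    case (inj₂ ≡.refl) = x≈y⇒x∙y⁻¹≈ε (sym (trans (*-comm _ _) (^-congʳ _ (ℕ.m+[n∸m]≡n {1} (ℕ.<⇒≤ F.1<q)))))

  -- The coefficients of t^(qⁿ) = ∑ᵢ η n i · eᵢ(t), the expansion inverse to ε.
  η : ℕ → ℕ → Carrier
  η zero    zero    = 1#
  η zero    (suc i) = 0#
  η (suc n) zero    = η n zero ^ q * Δ zero
  η (suc n) (suc i) = η n i ^ q + η n (suc i) ^ q * Δ (suc i)

  ∣η∣≤1 : ∀ n i → ∣ η n i ∣≤q^ 0ℚ
  ∣η∣≤1 zero    zero    = ≤q^-1
  ∣η∣≤1 zero    (suc i) = ≈0⇒≤q^ 0ℚ refl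
  ∣η∣≤1 (suc n) zero    = ≤q^-*ˡ (≤q^-^ q (∣η∣≤1 n zero)) (∣Δ∣≤1 zero)
  ∣η∣≤1 (suc n) (suc i) = ≤q^-+ (≤q^-^ q (∣η∣≤1 n i)) (≤q^-*ˡ (≤q^-^ q (∣η∣≤1 n (suc i))) (∣Δ∣≤1 (suc i)))

  η-vanishes : ∀ n i → n < i → η n i ≈ 0#
  η-vanishes zero    (suc i) _         = refl
  η-vanishes (suc n) (suc i) (s≤s n<i) = trans
    (+-cong (trans (^-congˡ q (η-vanishes n i n<i)) (0^n≈0 q))
            (trans (*-congʳ (trans (^-congˡ q (η-vanishes n (suc i) (ℕ.m≤n⇒m≤1+n n<i))) (0^n≈0 q))) (zeroˡ (Δ (suc i)))))
    (+-identityʳ 0#)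

  -- The recursion solved for the q-th power; its two terms are the origin of the two terms in the
  -- recursion for `η`.
  e^q : ∀ n t → e n t ^ q ≈ e (suc n) t + Δ n * e n t
  e^q n t = trans (sym (a-b+b≈a _ (Δ n * e n t))) (+-congʳ (sym (e-suc n t)))

  ^q^n-expansion : ∀ n N t → n < N → t ^ (q ℕ.^ n) ≈ ∑< N λ i → η n i * e i t
  ^q^n-expansion zero    (suc N) t _ = sym (trans
    (+-cong (*-identityˡ t) (trans (∑<-cong N {g = λ _ → 0#} λ i _ → zeroˡ (e (suc i) t)) (∑<-0 N)))
    (trans (+-identityʳ t) (sym (*-identityʳ t))))
  ^q^n-expansion (suc n) (suc N) t (s≤s n<N) = begin
    t ^ (q ℕ.^ suc n)                          ≈⟨ [^q^i]^q t n ⟨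
    (t ^ (q ℕ.^ n)) ^ q                        ≈⟨ ^-congˡ q (^q^n-expansion n N t n<N) ⟩
    ∑< N (λ i → η n i * e i t) ^ q             ≈⟨ additive-∑< q additive-q N (λ i → η n i * e i t) ⟩
    ∑< N (λ i → (η n i * e i t) ^ q)           ≈⟨ ∑<-cong N (λ i _ → power i) ⟩
    ∑< N (λ i → a (suc i) + b i)               ≈⟨ ∑<-+ N (a ∘ suc) b ⟩
    -- To reach the common range `suc N`, the shifted sum is padded in front by `a zero` and the
    -- other at the end by `b N`, which vanishes since n < N.
    ∑< N (a ∘ suc) + ∑< N b                    ≈⟨ +-cong (+-identityˡ _) (trans (∑<-last N b) (trans (+-congˡ bN≈0) (+-identityʳ _))) ⟨
    ∑< (suc N) a + ∑< (suc N) b                ≈⟨ ∑<-+ (suc N) a b ⟨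
    ∑< (suc N) (λ i → a i + b i)               ≈⟨ ∑<-cong (suc N) (λ i _ → term i) ⟩
    ∑< (suc N) (λ i → η (suc n) i * e i t)     ∎
    where
    a b : ℕ → Carrier
    a zero    = 0#
    a (suc i) = η n i ^ q * e (suc i) t
    b i       = η n i ^ q * Δ i * e i t
    bN≈0 : b N ≈ 0#
    bN≈0 = trans (*-congʳ (trans (*-congʳ (trans (^-congˡ q (η-vanishes n N n<N)) (0^n≈0 q))) (zeroˡ _))) (zeroˡ _)
    power : ∀ i → (η n i * e i t) ^ q ≈ a (suc i) + b i
    power i = begin
      (η n i * e i t) ^ q                              ≈⟨ ^-distrib-* (η n i) (e i t) q ⟩
      η n i ^ q * e i t ^ q                            ≈⟨ *-congˡ (e^q i t) ⟩
      η n i ^ q * (e (suc i) t + Δ i * e i t)          ≈⟨ distribˡ _ _ _ ⟩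
      a (suc i) + η n i ^ q * (Δ i * e i t)            ≈⟨ +-congˡ (*-assoc _ _ _) ⟨
      a (suc i) + b i                                  ∎
    term : ∀ i → a i + b i ≈ η (suc n) i * e i t
    term zero    = +-identityˡ _
    term (suc i) = sym (distribʳ _ _ _)

  -- The order of Dₙ

  record Order (z : Carrier) (k : ℕ) : Set ℓ₂′ where
    constructor _,_
    field
      nonZero : z # 0#
      log≡    : log z nonZero ≡ ℚ.- fromNat k

  order-1 : Order 1# 0
  order-1 = 1#0 , log-1 1#0

  order-* : ∀ {z w k l} → Order z k → Order w l → Order (z * w) (k ℕ.+ l)
  order-* {z} {w} {k} {l} (z#0 , log-z) (w#0 , log-w) = x#0y#0→xy#0 z#0 w#0 ,
    ≡.trans (log-* z w z#0 w#0 _) (≡.trans (≡.cong₂ ℚ._+_ log-z log-w)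
    (≡.trans (≡.sym (ℚ.neg-distrib-+ (fromNat k) (fromNat l))) (≡.cong ℚ.-_ (≡.sym (fromNat-+ k l)))))

  order-^ : ∀ {z k} n → Order z k → Order (z ^ n) (n ℕ.* k)
  order-^ zero    _ = order-1
  order-^ (suc n) o = order-* o (order-^ n o)

  order-∏< : ∀ n g s → (∀ k → k < n → Order (g k) (s k)) → Order (∏< n g) (sumℕ n s)
  order-∏< zero    g s _ = order-1
  order-∏< (suc n) g s o = order-* (o 0 (s≤s z≤n)) (order-∏< n (g ∘ suc) (s ∘ suc) λ k k<n → o (suc k) (s≤s k<n))

  order-x : Order x 1
  order-x = x#0 , log-x x#0

  -- For n ≥ 2, |zⁿ| ≤ q⁻² < q⁻¹ = |z|, so -z dominates. At z = x this gives |[i]| = q⁻¹ for i ≥ 1.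
  order-z^n-z : ∀ {z} n → Order z 1 → 1 < n → Order (z ^ n - z) 1
  order-z^n-z {z} n (z#0 , log-z) 1<n = #-congʳ (+-comm _ _) nz ,
    ≡.trans (log-cong (+-comm _ _) _ nz) (≡.trans (log-+-dominant (-#0 z#0) z^n≤ -2<logz nz) log-‿z)
    where
    -2ℚ = ℚ.- fromNat 2
    log-‿z : log (- z) (-#0 z#0) ≡ ℚ.- fromNat 1
    log-‿z = ≡.trans (log-‿ z z#0 _) log-z
    z^n≤ : ∣ z ^ n ∣≤q^ -2ℚ
    z^n≤ = power n 1<n
      where
      z≤ : ∣ z ∣≤q^ (ℚ.- fromNat 1)
      z≤ nz = ℚ.≤-reflexive (≡.trans (log-cong refl nz z#0) log-z)
      power : ∀ n → 1 < n → ∣ z ^ n ∣≤q^ -2ℚ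
      power (suc zero)    (s≤s ())
      power (suc (suc n)) _ = ≤q^-* z≤ (≤q^-*ʳ z≤ (≤q^-^ n (≤q^-mono -1≤0 z≤)))
    -2<logz : -2ℚ ℚ.< log (- z) (-#0 z#0)
    -2<logz = ≡.subst (-2ℚ ℚ.<_) (≡.sym log-‿z) (ℚ.*<* (ℤ.-<- (s≤s z≤n)))
    nz : - z + z ^ n # 0#
    nz = +-dominant-#0 (-#0 z#0) z^n≤ -2<logz

  -- Every bracket in Dₙ has order 1, so the orders add up to the exponents 1 + q + ... + q^(n-1).
  order-D : ∀ n → Order (D n) (sumℕ n (q ℕ.^_))
  order-D n = order-∏< n _ _ λ k k<n → ≡.subst (Order _) (ℕ.*-identityʳ _)
    (order-^ (q ℕ.^ k) (order-z^n-z _ order-x (1<q^ (ℕ.m<n⇒0<n∸m k<n))))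
    where
    1<q^ : ∀ {i} → 0 < i → 1 < q ℕ.^ i
    1<q^ {suc i} _ = ℕ.<-≤-trans F.1<q (ℕ.m≤m*n q (q ℕ.^ i) {{ℕ.m^n≢0 q i}})

  -- The logarithm to base q of q^(qⁿ/(q − 1)) · |Dₙ| is 1/(q − 1).
  log-D-bounds : ∀ n nz → (0ℚ ℚ.≤ q^n/[q-1] n ℚ.+ log (D n) nz) × (q^n/[q-1] n ℚ.+ log (D n) nz ℚ.≤ 1ℚ)
  log-D-bounds n nz =
    ≡.subst₂ ℚ._≤_ (ℚ.+-inverseʳ (fromNat s)) (≡.sym (≡.cong₂ ℚ._+_ fraction log-D))
      (ℚ.+-monoˡ-≤ (ℚ.- fromNat s) (proj₁ bounds)) ,
    ≡.subst₂ ℚ._≤_ (≡.sym (≡.cong₂ ℚ._+_ fraction log-D)) cancel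
      (ℚ.+-monoˡ-≤ (ℚ.- fromNat s) (proj₂ bounds))
    where
    s = sumℕ n (q ℕ.^_)
    log-D : log (D n) nz ≡ ℚ.- fromNat s
    log-D = ≡.trans (log-cong refl nz _) (Order.log≡ (order-D n))
    -- `geometric` has a successor as its base, so q is rewritten as 1 + (q ∸ 1).
    q^n : q ℕ.^ n ≡ 1 ℕ.+ (q ℕ.∸ 1) ℕ.* s
    q^n = ≡.subst (λ k → k ℕ.^ n ≡ 1 ℕ.+ (q ℕ.∸ 1) ℕ.* sumℕ n (k ℕ.^_)) (ℕ.m+[n∸m]≡n {1} (ℕ.<⇒≤ F.1<q)) (geometric (q ℕ.∸ 1) n)
    fraction : q^n/[q-1] n ≡ + (1 ℕ.+ (q ℕ.∸ 1) ℕ.* s) ℚ./ (q ℕ.∸ 1)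
    fraction = ≡.cong (λ k → + k ℚ./ (q ℕ.∸ 1)) q^n
    bounds = [1+d*s]/d-bounds (q ℕ.∸ 1) s
    cancel : fromNat (1 ℕ.+ s) ℚ.+ (ℚ.- fromNat s) ≡ 1ℚ
    cancel = ≡.trans (≡.cong (ℚ._- fromNat s) (fromNat-+ 1 s)) (≡.trans (ℚ.+-assoc 1ℚ (fromNat s) (ℚ.- fromNat s))
      (≡.trans (≡.cong (1ℚ ℚ.+_) (ℚ.+-inverseʳ (fromNat s))) (ℚ.+-identityʳ 1ℚ)))

  UniformlyExpands : C₀ → (ℕ → Carrier) → Set _
  UniformlyExpands u d = ∀ r → ∃[ N ] ∀ n → N ℕ.≤ n → ∀ t →
    ∣ ∑< n (λ i → d i * e i (ι ⌊ t ⌋)) - ⟦ u ⟧ t ∣≤q^ r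

-- Null sequences and the two directions for the coefficients dₙ.

module NullSequences {c ℓ₁ ℓ₂} (V : ValuedField c ℓ₁ ℓ₂) where
  open ValuedField V hiding (zero)
  open FieldProperties heytingField
  open ValuedProperties V

  Null : (ℕ → Carrier) → Set _
  Null s = ∀ r → ∃[ N ] ∀ n → N ℕ.≤ n → ∣ s n ∣≤q^ r

  null⇒⟶0 : ∀ {s} → Null s → s ⟶ 0#
  null⇒⟶0 null r with null r
  ... | N , s≤ = N , λ n N≤n → ≤q^-cong (sym (x-0≈x _)) (s≤ n N≤n)

  ⟶0⇒null : ∀ {s} → s ⟶ 0# → Null s
  ⟶0⇒null s⟶0 r with s⟶0 r
  ... | N , s≤ = N , λ n N≤n → ≤q^-cong (x-0≈x _) (s≤ n N≤n)

module UnnormalizedExpansion {f f₁ f₂ c ℓ₁ ℓ₂ c′ ℓ₁′ ℓ₂′} (𝐅 : FiniteField f f₁ f₂)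
       (𝐊 : CompletedAlgebraicClosure 𝐅 c ℓ₁ ℓ₂ c′ ℓ₁′ ℓ₂′)
       (u : Carlitz.C₀ 𝐅 𝐊) (ds : ℕ → Carlitz.Carrier 𝐅 𝐊)
       (ds-uniform : CarlitzExpansions.UniformlyExpands 𝐅 𝐊 u ds) where
  open CompletedAlgebraicClosure 𝐊
  open LaurentSeries 𝐅 using (⌊_⌋)
  open Carlitz 𝐅 𝐊
  open C₀ using (⟦_⟧)
  private module F = FiniteField 𝐅
  open F using (q)
  open LaurentSeriesProperties 𝐅
  open ValuedField K̄c hiding (Carrier; q^_·∣_∣⟶0; zero)
  open FieldProperties heytingField
  open ValuedProperties K̄c
  open NullSequences K̄c
  open CarlitzProperties 𝐅 𝐊
  open CarlitzExpansions 𝐅 𝐊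
  open SetoidReasoning setoid

  module Sufficiency (d-null : Null ds) where
    partial : ℕ → ℕ → Carrier
    partial i N = ∑< N λ n → ds n * ε n i

    -- The same N serves every i, because |ε| ≤ 1 throughout; this uniformity is what permits the
    -- rearrangement.
    partial-tail : ∀ {r N} → (∀ n → N ℕ.≤ n → ∣ ds n ∣≤q^ r) → ∀ i M → N ℕ.≤ M → ∣ partial i M - partial i N ∣≤q^ r
    partial-tail d≤ i M N≤M = ∑<-tail-≤q^ _ _ M N≤M λ n N≤n → ≤q^-*ʳ (d≤ n N≤n) (∣ε∣≤1 n i)

    partial-cauchy : ∀ i → Cauchy (partial i)
    partial-cauchy i r with d-null r
    ... | N , d≤ = N , λ m n N≤m N≤n →
      ≤q^-trans (partial-tail d≤ i m N≤m) (≤q^-comm (partial-tail d≤ i n N≤n))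

    abstract
      limit : ∀ i → ∃[ l ] partial i ⟶ l
      limit i = IsCompletion.complete isCompletion (partial i) (partial-cauchy i)

    as : ℕ → Carrier
    as i = proj₁ (limit i)

    -- The limit inherits the uniform tail bound: both sides are compared with one partial sum
    -- beyond M and beyond the point where the limit is within the bound.
    as-partial : ∀ {r N} → (∀ n → N ℕ.≤ n → ∣ ds n ∣≤q^ r) → ∀ i M → N ℕ.≤ M → ∣ as i - partial i M ∣≤q^ r
    as-partial {r} {N} d≤ i M N≤M with proj₂ (limit i) r
    ... | N′ , close = ≤q^-trans (≤q^-comm (close (M ⊔ N′) (ℕ.m≤n⊔m M N′)))
          (partial-tail (λ n M≤n → d≤ n (ℕ.≤-trans N≤M M≤n)) i (M ⊔ N′) (ℕ.m≤m⊔n M N′))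

    -- For i ≥ N the partial sum `partial i N` is 0, since `ε n i` vanishes for n < i; only the tail
    -- beyond N is left.
    as-null : Null as
    as-null r with d-null r
    ... | N , d≤ = N , λ i N≤i → ≤q^-cong (a-b+b≈a _ _) (≤q^-+ (as-partial d≤ i N ℕ.≤-refl)
          (≤q^-∑< N _ λ n n<N → ≈0⇒≤q^ r (trans (*-congˡ (ε-vanishes n i (ℕ.<-≤-trans n<N N≤i))) (zeroʳ (ds n)))))

    -- Both expansions are cut off at the same M: `ε` is triangular, so the summation range can be
    -- completed to a square and interchanged.
    partial-sum : ∀ M t → ∑< M (λ i → partial i M * t ^ (q ℕ.^ i)) ≈ ∑< M (λ n → ds n * e n t)
    partial-sum M t = begin
      ∑< M (λ i → partial i M * t ^ (q ℕ.^ i))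
        ≈⟨ ∑<-cong M (λ i _ → ∑<-*ʳ M (t ^ (q ℕ.^ i)) (λ n → ds n * ε n i)) ⟩
      ∑< M (λ i → ∑< M λ n → ds n * ε n i * t ^ (q ℕ.^ i))
        ≈⟨ ∑<-comm M M (λ i n → ds n * ε n i * t ^ (q ℕ.^ i)) ⟩
      ∑< M (λ n → ∑< M λ i → ds n * ε n i * t ^ (q ℕ.^ i))
        ≈⟨ ∑<-cong M (λ n n<M → sym (collect n n<M)) ⟩
      ∑< M (λ n → ds n * e n t) ∎
      where
      collect : ∀ n → n < M → ds n * e n t ≈ ∑< M λ i → ds n * ε n i * t ^ (q ℕ.^ i)
      collect n n<M = begin
        ds n * e n t                                     ≈⟨ *-congˡ (e-expansion n M t n<M) ⟩
        ds n * ∑< M (λ i → ε n i * t ^ (q ℕ.^ i))        ≈⟨ ∑<-*ˡ M (ds n) (λ i → ε n i * t ^ (q ℕ.^ i)) ⟩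
        ∑< M (λ i → ds n * (ε n i * t ^ (q ℕ.^ i)))      ≈⟨ ∑<-cong M (λ i _ → *-assoc (ds n) (ε n i) (t ^ (q ℕ.^ i))) ⟨
        ∑< M (λ i → ds n * ε n i * t ^ (q ℕ.^ i))        ∎

    -- The M-th partial sum of the power series is compared term by term with ∑ `partial i M` ·
    -- t^(qⁱ), uniformly in i, and the latter is the M-th partial sum of the expansion of u in the
    -- eₙ.
    converges : ∀ t → (λ N → ∑< N λ n → as n * ι ⌊ t ⌋ ^ (q ℕ.^ n)) ⟶ ⟦ u ⟧ t
    converges t r with d-null r | ds-uniform r
    ... | N , d≤ | N′ , close = N ⊔ N′ , λ M N⊔N′≤M →
      let N≤M  = ℕ.≤-trans (ℕ.m≤m⊔n N N′) N⊔N′≤M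
          N′≤M = ℕ.≤-trans (ℕ.m≤n⊔m N N′) N⊔N′≤M
      in ≤q^-trans
        (≤q^-cong (∑<-minus M (λ i → as i * z i) (λ i → partial i M * z i))
          (≤q^-∑< M _ λ i _ → ≤q^-cong ([y-z]x≈yx-zx (z i) (as i) (partial i M))
            (≤q^-*ʳ (as-partial d≤ i M N≤M) (≤q^-^ (q ℕ.^ i) (∣O∣≤1 t)))))
        (≤q^-cong (+-congʳ (sym (partial-sum M (ι ⌊ t ⌋)))) (close M N′≤M t))
      where
      z : ℕ → Carrier
      z i = ι ⌊ t ⌋ ^ (q ℕ.^ i)

    u∈A : u ∈A
    u∈A = as , null⇒⟶0 as-null , converges

  module Necessity (as : ℕ → Carrier) (as-null : Null as)
                   (converges : ∀ t → (λ N → ∑< N λ n → as n * ι ⌊ t ⌋ ^ (q ℕ.^ n)) ⟶ ⟦ u ⟧ t) where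
    partial : ℕ → ℕ → Carrier
    partial i N = ∑< N λ n → as n * η n i

    partial-sum : ∀ M t → ∑< M (λ n → as n * t ^ (q ℕ.^ n)) ≈ ∑< M (λ i → partial i M * e i t)
    partial-sum M t = begin
      ∑< M (λ n → as n * t ^ (q ℕ.^ n))
        ≈⟨ ∑<-cong M distribute ⟩
      ∑< M (λ n → ∑< M λ i → as n * η n i * e i t)
        ≈⟨ ∑<-comm M M (λ n i → as n * η n i * e i t) ⟩
      ∑< M (λ i → ∑< M λ n → as n * η n i * e i t)
        ≈⟨ ∑<-cong M (λ i _ → ∑<-*ʳ M (e i t) (λ n → as n * η n i)) ⟨
      ∑< M (λ i → partial i M * e i t) ∎
      where
      distribute : ∀ n → n < M → as n * t ^ (q ℕ.^ n) ≈ ∑< M λ i → as n * η n i * e i t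
      distribute n n<M = begin
        as n * t ^ (q ℕ.^ n)                   ≈⟨ *-congˡ (^q^n-expansion n M t n<M) ⟩
        as n * ∑< M (λ i → η n i * e i t)      ≈⟨ ∑<-*ˡ M (as n) (λ i → η n i * e i t) ⟩
        ∑< M (λ i → as n * (η n i * e i t))    ≈⟨ ∑<-cong M (λ i _ → *-assoc (as n) (η n i) (e i t)) ⟨
        ∑< M (λ i → as n * η n i * e i t)      ∎

    -- At t = xʲ all eᵢ(t) with i > j vanish, which isolates dⱼ once the earlier coefficients
    -- are known to be close.
    isolate : ∀ {y r} j (y#0 : e j y # 0#) M → j < M → ∣ y ∣≤q^ 0ℚ →
      (∀ i → j < i → e i y ≈ 0#) →
      ∣ ∑< M (λ i → ds i * e i y) - ∑< M (λ n → as n * y ^ (q ℕ.^ n)) ∣≤q^ (log (e j y) y#0 ℚ.+ r) →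
      (∀ i → i < j → ∣ ds i - partial i M ∣≤q^ (log (e j y) y#0 ℚ.+ r)) →
      ∣ ds j - partial j M ∣≤q^ r
    isolate {y} {r} j y#0 M j<M y≤1 e≈0 difference≤ earlier =
      ≤q^-divide y#0 (∑<-isolate-≤q^ g M j j<M (≤q^-cong (sym ∑g) difference≤) others)
      where
      g : ℕ → Carrier
      g i = e i y * (ds i - partial i M)
      ∑g : ∑< M g ≈ ∑< M (λ i → ds i * e i y) - ∑< M (λ n → as n * y ^ (q ℕ.^ n))
      ∑g = begin
        ∑< M g ≈⟨ ∑<-cong M (λ i _ → trans (*-comm _ _) ([y-z]x≈yx-zx (e i y) (ds i) (partial i M))) ⟩
        ∑< M (λ i → ds i * e i y - partial i M * e i y) ≈⟨ ∑<-minus M (λ i → ds i * e i y) (λ i → partial i M * e i y) ⟩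
        ∑< M (λ i → ds i * e i y) - ∑< M (λ i → partial i M * e i y) ≈⟨ +-congˡ (-‿cong (partial-sum M y)) ⟨
        ∑< M (λ i → ds i * e i y) - ∑< M (λ n → as n * y ^ (q ℕ.^ n)) ∎
      others : ∀ i → i ≢ j → ∣ g i ∣≤q^ (log (e j y) y#0 ℚ.+ r)
      others i i≢j with ℕ.<-cmp i j
      ... | tri< i<j _ _ = ≤q^-*ˡ (∣e∣≤1 i y≤1) (earlier i i<j)
      ... | tri≈ _ i≡j _ = ⊥-elim (i≢j i≡j)
      ... | tri> _ _ j<i = ≈0⇒≤q^ _ (trans (*-congʳ (e≈0 i j<i)) (zeroˡ (ds i - partial i M)))

    -- The coefficients of eᵢ in the finite sums tend to `ds i`, with a common N for the finitely
    -- many i < j. No uniformity in j is claimed.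
    Approximated : ℕ → Set _
    Approximated j = ∀ r → ∃[ N ] ∀ M → N ℕ.≤ M → ∀ i → i < j → ∣ ds i - partial i M ∣≤q^ r

    approximate-next : ∀ j t → ι ⌊ t ⌋ ≈ x ^ j → Approximated j → Approximated (suc j)
    approximate-next j t t≈x^j earlier r =
      choose (#-congʳ (sym (e-cong j t≈x^j)) (e-x^n#0 j))
      where
      y = ι ⌊ t ⌋
      choose : e j y # 0# → ∃[ N ] ∀ M → N ℕ.≤ M → ∀ i → i < suc j → ∣ ds i - partial i M ∣≤q^ r
      choose y#0 = combine (earlier r) (earlier r′) (ds-uniform r′) (converges t r′)
        where
        -- Dividing by eⱼ(xʲ) enlarges errors by 1/|eⱼ(xʲ)|, so its inputs are requested with that
        -- much more accuracy. The earlier coefficients are requested twice: at `r` for the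
        -- conclusion, at `r′` as input.
        r′ = log (e j y) y#0 ℚ.+ r
        combine : (∃[ N ] ∀ M → N ℕ.≤ M → ∀ i → i < j → ∣ ds i - partial i M ∣≤q^ r) →
                  (∃[ N ] ∀ M → N ℕ.≤ M → ∀ i → i < j → ∣ ds i - partial i M ∣≤q^ r′) →
                  (∃[ N ] ∀ M → N ℕ.≤ M → ∀ t → ∣ ∑< M (λ i → ds i * e i (ι ⌊ t ⌋)) - ⟦ u ⟧ t ∣≤q^ r′) →
                  (∃[ N ] ∀ M → N ℕ.≤ M → ∣ ∑< M (λ n → as n * y ^ (q ℕ.^ n)) - ⟦ u ⟧ t ∣≤q^ r′) →
                  ∃[ N ] ∀ M → N ℕ.≤ M → ∀ i → i < suc j → ∣ ds i - partial i M ∣≤q^ r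
        -- `suc j` enters the maximum so that index j lies inside the sums up to M.
        combine (N₁ , p₁) (N₂ , p₂) (N₃ , p₃) (N₄ , p₄) = N₁ ⊔ (N₂ ⊔ (N₃ ⊔ (N₄ ⊔ suc j))) , bound
          where
          bound : ∀ M → N₁ ⊔ (N₂ ⊔ (N₃ ⊔ (N₄ ⊔ suc j))) ℕ.≤ M → ∀ i → i < suc j → ∣ ds i - partial i M ∣≤q^ r
          bound M N≤M i i<1+j = [ p₁ M N₁≤M i , (λ { ≡.refl → last }) ]′ (ℕ.m≤n⇒m<n∨m≡n (ℕ.≤-pred i<1+j))
            where
            N₁≤M = ℕ.m⊔n≤o⇒m≤o N₁ _ N≤M
            N₂⊔≤M = ℕ.m⊔n≤o⇒n≤o N₁ _ N≤M
            N₂≤M = ℕ.m⊔n≤o⇒m≤o N₂ _ N₂⊔≤M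
            N₃⊔≤M = ℕ.m⊔n≤o⇒n≤o N₂ _ N₂⊔≤M
            N₃≤M = ℕ.m⊔n≤o⇒m≤o N₃ _ N₃⊔≤M
            N₄⊔≤M = ℕ.m⊔n≤o⇒n≤o N₃ _ N₃⊔≤M
            N₄≤M = ℕ.m⊔n≤o⇒m≤o N₄ _ N₄⊔≤M
            j<M = ℕ.m⊔n≤o⇒n≤o N₄ _ N₄⊔≤M
            last : ∣ ds j - partial j M ∣≤q^ r
            last = isolate j y#0 M j<M (∣O∣≤1 t) (λ i j<i → trans (e-cong i t≈x^j) (e-x^j≈0 i j j<i))
              (≤q^-trans (p₃ M N₃≤M t) (≤q^-comm (p₄ M N₄≤M))) (p₂ M N₂≤M)

    approximated : ∀ j → Approximated j
    approximated zero    r = 0 , λ _ _ _ ()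
    approximated (suc j)   = approximate-next j (X^ᴼ j) (ι-X^ j) (approximated j)

    -- The M chosen for approximating `ds j` depends on j, but the bound does not: for j ≥ N the
    -- terms with n < N vanish by triangularity of `η`, and the others are bounded by |aₙ| with n ≥
    -- N.
    d-null : Null ds
    d-null r with as-null r
    ... | N , a≤ = N , λ j N≤j → bound j N≤j (approximated (suc j) r)
      where
      bound : ∀ j → N ℕ.≤ j → (∃[ M ] ∀ M′ → M ℕ.≤ M′ → ∀ i → i < suc j → ∣ ds i - partial i M′ ∣≤q^ r) → ∣ ds j ∣≤q^ r
      bound j N≤j (M , close) = ≤q^-cong (a-b+b≈a _ _) (≤q^-+ (close M ℕ.≤-refl j (ℕ.n<1+n j)) (≤q^-∑< M _ λ n _ → term n))
        where
        term : ∀ n → ∣ as n * η n j ∣≤q^ r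
        term n with n ℕ.<? N
        ... | yes n<N = ≈0⇒≤q^ r (trans (*-congˡ (η-vanishes n j (ℕ.<-≤-trans n<N N≤j))) (zeroʳ (as n)))
        ... | no  n≮N = ≤q^-*ʳ (a≤ n (ℕ.≮⇒≥ n≮N)) (∣η∣≤1 n j)

-- From the coefficients cₙ to dₙ = cₙ/Dₙ, and the criterion.

module Criterion {f f₁ f₂ c ℓ₁ ℓ₂ c′ ℓ₁′ ℓ₂′} (𝐅 : FiniteField f f₁ f₂)
       (𝐊 : CompletedAlgebraicClosure 𝐅 c ℓ₁ ℓ₂ c′ ℓ₁′ ℓ₂′)
       (u : Carlitz.C₀ 𝐅 𝐊) (cs : ℕ → Carlitz.Carrier 𝐅 𝐊)
       (expansion : Carlitz._IsCarlitzExpansionOf_ 𝐅 𝐊 cs u) where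
  open CompletedAlgebraicClosure 𝐊
  open LaurentSeries 𝐅 using (⌊_⌋)
  open Carlitz 𝐅 𝐊
  open _IsCarlitzExpansionOf_ expansion using (uniform)
  open ValuedField K̄c hiding (Carrier; q^_·∣_∣⟶0; zero)
  open FieldProperties heytingField
  open ValuedProperties K̄c
  open CarlitzProperties 𝐅 𝐊
  open CarlitzExpansions 𝐅 𝐊
  open NullSequences K̄c

  ds : ℕ → Carrier
  ds n = inverse (D#0 n) * cs n

  D*d≈c : ∀ n → D n * ds n ≈ cs n
  D*d≈c n = trans (sym (*-assoc _ _ _)) (trans (*-congʳ (inverseʳ (D#0 n))) (*-identityˡ _))

  c*f̂≈d*e : ∀ n t → cs n * f̂ n t ≈ ds n * e n t
  c*f̂≈d*e n t = trans (sym (*-assoc _ _ _)) (*-congʳ (*-comm _ _))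

  ds-uniform : UniformlyExpands u ds
  ds-uniform r with uniform r
  ... | N , ≤r = N , λ n N≤n t → ≤q^-cong (+-congʳ (∑<-cong n λ i _ → c*f̂≈d*e i (ι ⌊ t ⌋))) (≤r n N≤n t)

  log-c : ∀ n c#0 d#0 → log (cs n) c#0 ≡ log (D n) (D#0 n) ℚ.+ log (ds n) d#0
  log-c n c#0 d#0 = ≡.trans (log-cong (sym (D*d≈c n)) c#0 nz) (log-* (D n) (ds n) (D#0 n) d#0 nz)
    where nz = x#0y#0→xy#0 (D#0 n) d#0

  q^·c : ∀ n c#0 d#0 → q^n/[q-1] n ℚ.+ log (cs n) c#0 ≡ (q^n/[q-1] n ℚ.+ log (D n) (D#0 n)) ℚ.+ log (ds n) d#0
  q^·c n c#0 d#0 = ≡.trans (≡.cong (q^n/[q-1] n ℚ.+_) (log-c n c#0 d#0)) (≡.sym (ℚ.+-assoc (q^n/[q-1] n) _ _))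

  d-null⇒c : Null ds → q^ q^n/[q-1] ·∣ cs ∣⟶0
  -- The factor q^(qⁿ/(q-1)) |Dₙ| is at most q¹; the -1 compensates for it.
  d-null⇒c null r with null (ℚ.- 1ℚ ℚ.+ r)
  ... | N , d≤ = N , λ n N≤n c#0 → bound n N≤n c#0 (*#0⇒#0ʳ (#-congʳ (sym (D*d≈c n)) c#0))
    where
    1-1+r≡r : 1ℚ ℚ.+ (ℚ.- 1ℚ ℚ.+ r) ≡ r
    1-1+r≡r = ≡.trans (≡.sym (ℚ.+-assoc 1ℚ (ℚ.- 1ℚ) r)) (≡.trans (≡.cong (ℚ._+ r) (ℚ.+-inverseʳ 1ℚ)) (ℚ.+-identityˡ r))
    bound : ∀ n → N ℕ.≤ n → ∀ c#0 → ds n # 0# → q^n/[q-1] n ℚ.+ log (cs n) c#0 ℚ.≤ r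
    bound n N≤n c#0 d#0 = ≡.subst₂ ℚ._≤_ (≡.sym (q^·c n c#0 d#0)) 1-1+r≡r
      (ℚ.+-mono-≤ (proj₂ (log-D-bounds n (D#0 n))) (d≤ n N≤n d#0))

  -- The same factor is at least 1, so here no accuracy is lost and `r` is used unchanged.
  c⇒d-null : q^ q^n/[q-1] ·∣ cs ∣⟶0 → Null ds
  c⇒d-null c⟶0 r with c⟶0 r
  ... | N , c≤ = N , λ n N≤n d#0 → bound n N≤n d#0 (#-congʳ (D*d≈c n) (x#0y#0→xy#0 (D#0 n) d#0))
    where
    bound : ∀ n → N ℕ.≤ n → ∀ d#0 → cs n # 0# → log (ds n) d#0 ℚ.≤ r
    bound n N≤n d#0 c#0 = ℚ.≤-trans (≡.subst₂ ℚ._≤_ (ℚ.+-identityˡ _) (≡.sym (q^·c n c#0 d#0))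
      (ℚ.+-monoˡ-≤ (log (ds n) d#0) (proj₁ (log-D-bounds n (D#0 n))))) (c≤ n N≤n c#0)

  u∈A⇔ : (u ∈A) ⇔ (q^ q^n/[q-1] ·∣ cs ∣⟶0)
  u∈A⇔ = mk⇔
    (λ (as , as⟶0 , converges) → d-null⇒c (UnnormalizedExpansion.Necessity.d-null 𝐅 𝐊 u ds ds-uniform as (⟶0⇒null as⟶0) converges))
    (λ c⟶0 → UnnormalizedExpansion.Sufficiency.u∈A 𝐅 𝐊 u ds ds-uniform (c⇒d-null c⟶0))

theorem3 : ∀ {f f₁ f₂ k ℓ₁ ℓ₂ k′ ℓ₁′ ℓ₂′}
    (𝐅 : FiniteField f f₁ f₂)
    (𝐊 : CompletedAlgebraicClosure 𝐅 k ℓ₁ ℓ₂ k′ ℓ₁′ ℓ₂′) →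
    let open Carlitz 𝐅 𝐊 in
    (u : C₀) (c : ℕ → Carrier) → c IsCarlitzExpansionOf u →
    (u ∈A) ⇔ (q^ q^n/[q-1] ·∣ c ∣⟶0)
theorem3 𝐅 𝐊 u c expansion = Criterion.u∈A⇔ 𝐅 𝐊 u c expansion
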